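{- Let $\mathcal{C}$ be a nowhere-dense class of graphs which is uniformly quasi-wide with a computable margin $s_{\mathcal{C}}$ and a computable bound function $N_{\mathcal{C}}$. Then the following problem (DISTANCE-$d$-DOMINATING SET on $\mathcal{C}$) is fixed-parameter tractable. Input: a graph $G\in\mathcal{C}$, a set $W\subseteq V(G)$, and integers $k,d\ge 0$. Parameter: $k+d$. Problem: determine whether there is a set $X\subseteq V(G)$ of $k$ vertices which $d$-dominates $W$.
   Context: Graphs are finite, simple and undirected. $\mathrm{dist}^G(u,v)$ is the length of a shortest path from $u$ to $v$ in $G$, and $N_d^G(v)=\{u\in V(G):\mathrm{dist}^G(u,v)\le d\}$ (superscript dropped when clear). A set $X\subseteq V(G)$ $d$-dominates $W\subseteq V(G)$ if for every $u\in W$ there is $v\in X$ with $u\in N_d(v)$. A set $A\subseteq V(G)$ is $r$-scattered in $G$ if $N_r(u)\cap N_r(v)=\varnothing$ for all distinct $u,v\in A$. $G-S$ denotes the subgraph of $G$ induced by $V(G)\setminus S$. A graph $H$ is a minor of $G$ at depth $r$, written $H\preceq_r G$, if there are pairwise disjoint non-empty connected subgraphs $G_v$ of $G$ ($v\in V(H)$), called branch sets, such that for every edge $\{u,v\}$ of $H$ there is an edge of $G$ between a vertex of $G_u$ and a vertex of $G_v$, and each $G_v$ has radius at most $r$, i.e. there is $w\in V(G_v)$ with $V(G_v)\subseteq N_r^{G_v}(w)$. A class $\mathcal{C}$ of graphs is nowhere dense if for every $r\ge 0$ there is a graph $H$ such that $H\not\preceq_r G$ for all $G\in\mathcal{C}$.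 $\mathcal{C}$ is uniformly quasi-wide with margin $s_{\mathcal{C}}:\mathbb{N}\to\mathbb{N}$ and bound function $N_{\mathcal{C}}:\mathbb{N}\times\mathbb{N}\to\mathbb{N}$ if for all $r,m\ge 0$, every $G\in\mathcal{C}$ and every $W\subseteq V(G)$ with $|W|>N_{\mathcal{C}}(r,m)$, there is $S\subseteq V(G)$ with $|S|<s_{\mathcal{C}}(r)$ such that $W$ contains a set of size at least $m$ that is $r$-scattered in $G-S$. (It is a known theorem of Nešetřil and Ossona de Mendez that nowhere-dense classes are uniformly quasi-wide; the assumption is that the functions can be taken computable.) A parameterized problem is fixed-parameter tractable if there are a computable function $f$, a constant $c$, and an algorithm solving it in time $f(p)\cdot n^c$, where $p$ is the parameter and $n$ the order of the input graph; inputs are promised to satisfy $G\in\mathcal{C}$. -}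

module Defs where

open import Data.Bool using (Bool; true; false)
open import Data.Fin using (Fin)
open import Data.Fin.Subset using (Subset; _∈_; _⊆_; ∣_∣; ⊤; ∁; Nonempty)
open import Data.Fin.Subset.Properties using (_∈?_)
open import Data.List using (List; []; _∷_; tabulate)
open import Data.Nat using (ℕ; zero; suc; _+_; _*_; _^_; _≤_; _<_) renaming (_⊔_ to max)
open import Data.Product using (∃-syntax; _×_; _,_)
open import Data.Vec using (Vec; _∷_; lookup; _[_]≔_; replicate; head; toList)
open import Level using (0ℓ; _⊔_) renaming (suc to lsuc)
open import Relation.Binary using (Rel; Symmetric; Irreflexive; Decidable; _⇒_)
open import Relation.Binary.PropositionalEquality using (_≡_; _≢_)
open import Relation.Nullary using (¬_; does; Reflects)
open import Relation.Nullary.Decidable using (_×-dec_)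
open import Relation.Unary using (Pred; Empty; _∩_)

record Graph : Set₁ where
  infix 4 _~_ _~?_
  field
    order    : ℕ
    _~_      : Rel (Fin order) 0ℓ
    ~-sym    : Symmetric _~_
    ~-irrefl : Irreflexive _≡_ _~_
    _~?_     : Decidable _~_

open Graph using (order)

-- A subgraph keeps the vertex names of the ambient graph, so that
-- distances in G, in G − S and in a branch set are instances of a single
-- definition.
record Subgraph (G : Graph) : Set₁ where
  open Graph G using (_~_)
  infix 4 _—_ _—?_
  field
    verts : Subset (order G)
    _—_   : Rel (Fin (order G)) 0ℓ
    —-sym : Symmetric _—_
    —⇒~   : _—_ ⇒ _~_
    —⇒∈   : ∀ {u v} → u — v → u ∈ verts
    _—?_  : Decidable _—_

open Subgraph using (verts)

induced : (G : Graph) → Subset (order G) → Subgraph G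
induced G V = record
  { verts = V
  ; _—_   = λ u v → u ∈ V × v ∈ V × u ~ v
  ; —-sym = λ (u∈V , v∈V , u~v) → v∈V , u∈V , ~-sym u~v
  ; —⇒~   = λ (_ , _ , u~v) → u~v
  ; —⇒∈   = λ (u∈V , _) → u∈V
  ; _—?_  = λ u v → (u ∈? V) ×-dec (v ∈? V) ×-dec (u ~? v)
  }
  where open Graph G

whole : (G : Graph) → Subgraph G
whole G = induced G ⊤

infixl 6 _−_
_−_ : (G : Graph) → Subset (order G) → Subgraph G
G − S = induced G (∁ S)

module _ {G : Graph} where

  -- Repeated vertices are allowed; a walk of minimal length is a shortest
  -- path.
  data Walk (F : Subgraph G) : (u v : Fin (order G)) → ℕ → Set where
    stop : ∀ {u} → u ∈ verts F → Walk F u u 0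
    step : ∀ {u v w l} → Subgraph._—_ F u v → Walk F v w l → Walk F u w (suc l)

  -- dist^F(u,v) = l.  There is no such l when u and v are not connected
  -- in F, in particular when one of them is not a vertex of F.
  IsDist : Subgraph G → (u v : Fin (order G)) → ℕ → Set
  IsDist F u v l = Walk F u v l × (∀ {m} → Walk F u v m → l ≤ m)

  N : Subgraph G → ℕ → Fin (order G) → Pred (Fin (order G)) 0ℓ
  N F d v u = ∃[ l ] IsDist F u v l × l ≤ d

  Scattered : Subgraph G → ℕ → Subset (order G) → Set
  Scattered F r A =
    A ⊆ verts F ×
    (∀ {u v} → u ∈ A → v ∈ A → u ≢ v → Empty (N F r u ∩ N F r v))

  Connected : Subgraph G → Set
  Connected F = ∀ {u v} → u ∈ verts F → v ∈ verts F → ∃[ l ] Walk F u v l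

  RadiusAtMost : ℕ → Subgraph G → Set
  RadiusAtMost r F =
    ∃[ w ] w ∈ verts F × (∀ {u} → u ∈ verts F → N F r w u)

Dominates : (G : Graph) → ℕ → (X W : Subset (order G)) → Set
Dominates G d X W = ∀ {u} → u ∈ W → ∃[ v ] v ∈ X × N (whole G) d v u

infix 4 _≼[_]_
record _≼[_]_ (H : Graph) (r : ℕ) (G : Graph) : Set₁ where
  private
    module H = Graph H
    module G = Graph G
  field
    branch    : Fin H.order → Subgraph G
    nonempty  : ∀ v → Nonempty (verts (branch v))
    connected : ∀ v → Connected (branch v)
    radius    : ∀ v → RadiusAtMost r (branch v)
    disjoint  : ∀ {u v} → u ≢ v →
                Empty ((_∈ verts (branch u)) ∩ (_∈ verts (branch v)))
    edge      : ∀ {u v} → u H.~ v →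
                ∃[ x ] ∃[ y ] x ∈ verts (branch u) × y ∈ verts (branch v) × x G.~ y

NowhereDense : ∀ {ℓ} → Pred Graph ℓ → Set (lsuc 0ℓ ⊔ ℓ)
NowhereDense 𝒞 = ∀ r → ∃[ H ] (∀ G → 𝒞 G → ¬ (H ≼[ r ] G))

UniformlyQuasiWide :
  ∀ {ℓ} → Pred Graph ℓ → (margin : ℕ → ℕ) (bound : ℕ × ℕ → ℕ) →
  Set (lsuc 0ℓ ⊔ ℓ)
UniformlyQuasiWide 𝒞 margin bound =
  ∀ r m G → 𝒞 G → (W : Subset (order G)) → bound (r , m) < ∣ W ∣ →
  ∃[ S ] ∣ S ∣ < margin r ×
    (∃[ A ] A ⊆ W × m ≤ ∣ A ∣ × Scattered (G − S) r A)

-- The model of computation is Jones's WHILE language ("Computability and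
-- Complexity from a Programming Perspective").  Data are binary trees,
-- and time counts elementary operations.  With trees represented by
-- shared pointers every operation takes constant time, so running times
-- agree with those of Turing machines up to a polynomial.

infixr 5 _∙_
data 𝔻 : Set where
  nil : 𝔻
  _∙_ : 𝔻 → 𝔻 → 𝔻

-- Below, n is the number of program variables.

data Exp (n : ℕ) : Set where
  var   : Fin n → Exp n
  nil   : Exp n
  cons  : Exp n → Exp n → Exp n
  hd tl : Exp n → Exp n

infix  6 _:=_
infixr 5 _⨾_
data Cmd (n : ℕ) : Set where
  _:=_  : Fin n → Exp n → Cmd n
  _⨾_   : Cmd n → Cmd n → Cmd n
  while : Exp n → Cmd n → Cmd n

Store : ℕ → Set
Store = Vec 𝔻

left right : 𝔻 → 𝔻
left  nil     = nil
left  (a ∙ _) = a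
right nil     = nil
right (_ ∙ b) = b

module _ {n : ℕ} where

  eval : Exp n → Store n → 𝔻
  eval (var x)    σ = lookup σ x
  eval nil        σ = nil
  eval (cons e f) σ = eval e σ ∙ eval f σ
  eval (hd e)     σ = left (eval e σ)
  eval (tl e)     σ = right (eval e σ)

  cost : Exp n → ℕ
  cost (var x)    = 1
  cost nil        = 1
  cost (cons e f) = 1 + cost e + cost f
  cost (hd e)     = 1 + cost e
  cost (tl e)     = 1 + cost e

  -- ⟨ C , σ ⟩⇓⟨ τ , t ⟩: started in store σ, the command C terminates in
  -- store τ after time t.
  data ⟨_,_⟩⇓⟨_,_⟩ : Cmd n → Store n → Store n → ℕ → Set where
    assign : ∀ {x e σ} →
             ⟨ x := e , σ ⟩⇓⟨ σ [ x ]≔ eval e σ , 1 + cost e ⟩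
    seq    : ∀ {C D ρ σ τ s t} →
             ⟨ C , ρ ⟩⇓⟨ σ , s ⟩ → ⟨ D , σ ⟩⇓⟨ τ , t ⟩ →
             ⟨ C ⨾ D , ρ ⟩⇓⟨ τ , 1 + s + t ⟩
    exit   : ∀ {e C σ} → eval e σ ≡ nil →
             ⟨ while e C , σ ⟩⇓⟨ σ , 1 + cost e ⟩
    loop   : ∀ {e C ρ σ τ s t} → eval e ρ ≢ nil →
             ⟨ C , ρ ⟩⇓⟨ σ , s ⟩ → ⟨ while e C , σ ⟩⇓⟨ τ , t ⟩ →
             ⟨ while e C , ρ ⟩⇓⟨ τ , 1 + cost e + s + t ⟩

-- Variable zero holds the input initially and the output finally; all
-- other variables are initially nil.
record Program : Set where
  field
    extraVars : ℕ
    body      : Cmd (suc extraVars)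

_on_yields_within_ : Program → 𝔻 → 𝔻 → ℕ → Set
P on i yields o within b =
  ∃[ τ ] ∃[ t ] ⟨ body , i ∷ replicate extraVars nil ⟩⇓⟨ τ , t ⟩ ×
    head τ ≡ o × t ≤ b
  where open Program P

bool : Bool → 𝔻
bool false = nil
bool true  = nil ∙ nil

num : ℕ → 𝔻
num zero    = nil
num (suc n) = nil ∙ num n

numPair : ℕ × ℕ → 𝔻
numPair (m , n) = num m ∙ num n

list : ∀ {A : Set} → (A → 𝔻) → List A → 𝔻
list enc []       = nil
list enc (x ∷ xs) = enc x ∙ list enc xs

subset : ∀ {n} → Subset n → 𝔻
subset W = list bool (toList W)

adjacencyMatrix : Graph → 𝔻
adjacencyMatrix G =
  list (list bool) (tabulate λ u → tabulate λ v → does (u ~? v))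
  where open Graph G

Computable : ∀ {A : Set} → (A → 𝔻) → (A → ℕ) → Set
Computable enc f =
  ∃[ P ] (∀ a → ∃[ t ] P on enc a yields num (f a) within t)

record ParameterizedProblem ℓ : Set (lsuc (lsuc 0ℓ ⊔ ℓ)) where
  field
    Instance  : Set₁
    Promise   : Pred Instance ℓ
    Yes       : Pred Instance 0ℓ
    encode    : Instance → 𝔻
    size      : Instance → ℕ
    parameter : Instance → ℕ

-- The time bound is f(p)·n^c.  Only for n = 0 is n replaced by 1, since
-- otherwise c > 0 would allow no time at all.
FixedParameterTractable : ∀ {ℓ} → ParameterizedProblem ℓ → Set (lsuc 0ℓ ⊔ ℓ)
FixedParameterTractable Q =
  ∃[ f ] ∃[ c ] ∃[ P ] Computable num f ×
    (∀ x → Promise x → ∃[ b ]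
      P on encode x yields bool b
        within (f (parameter x) * (max 1 (size x)) ^ c) ×
      Reflects (Yes x) b)
  where open ParameterizedProblem Q

record DominationInstance : Set₁ where
  field
    G   : Graph
    W   : Subset (order G)
    k d : ℕ

DistanceDominatingSet : ∀ {ℓ} → Pred Graph ℓ → ParameterizedProblem ℓ
DistanceDominatingSet 𝒞 = record
  { Instance  = DominationInstance
  ; Promise   = λ x → 𝒞 (G x)
  ; Yes       = λ x → ∃[ X ] ∣ X ∣ ≡ k x × Dominates (G x) (d x) X (W x)
  ; encode    = λ x → adjacencyMatrix (G x) ∙ subset (W x) ∙ num (k x) ∙ num (d x)
  ; size      = λ x → order (G x)
  ; parameter = λ x → k x + d x
  }
  where open DominationInstance

{-# OPTIONS --safe #-}

-- The algorithm is a search tree.  A node holds k non-empty candidate sets, initially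
-- all of V(G).  Pick a vertex w ∈ W such that each candidate set has an element at
-- distance more than d from w.  If there is none, any choice of candidates is a solution.  Otherwise some candidate
-- set has to provide the vertex dominating w: branch over the k possibilities,
-- intersecting that set with the d-ball around w.
--
-- Along a branch w₁, w₂, … each wᵢ comes with k candidates dominating w₁, …, wᵢ₋₁ but
-- not wᵢ (a ladder).  If the branch is long, quasi-wideness yields a small S and a
-- large part of the branch which is d-scattered in G − S, and by pigeonhole k + 2 of
-- its vertices have the same distances, up to d, from S.  Take the last of them, w, and
-- its k vertices: one of these dominates two of the others, at least one of them
-- through S, and so it dominates w as well, a contradiction.
--
-- Hence the depth of the tree is at most N𝒞 (d , m) for an explicit m.  The algorithm
-- itself computes neither s𝒞 nor N𝒞: they enter the time bound only.

module Submission where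

open import Defs
open import Data.Bool using (Bool; true; false; _∧_; _∨_; not; if_then_else_)
open import Data.Bool.Properties using (∨-identityʳ; ∨-zeroʳ) renaming (_≟_ to _≟ᵇ_)
open import Data.Empty using (⊥; ⊥-elim)
open import Data.Fin using (Fin; zero; suc; toℕ; fromℕ<; inject≤; combine; remQuot)
open import Data.Fin.Properties using (any?; pigeonhole; toℕ-fromℕ<; remQuot-combine) renaming (_≟_ to _≟ᶠ_)
open import Data.Fin.Subset using (Subset; _∈_; _∉_; _⊆_; ∣_∣; ∁) renaming (⊥ to ⊥ˢ)
open import Data.Fin.Subset.Properties using (_∈?_; ∈⊤; ∉⊥; ∣⊥∣≡0; ∣p∣≤n; p⊆q⇒∣p∣≤∣q∣; x∉p⇒x∈∁p)
open import Data.List using (List; []; _∷_; length; filter; tabulate) renaming (lookup to lookupᴸ)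
open import Data.List.Membership.Propositional using () renaming (_∈_ to _∈ᴸ_)
open import Data.List.Membership.Propositional.Properties using (∈-filter⁺; ∈-lookup)
open import Data.List.Relation.Binary.Sublist.Propositional using ([]; _∷ʳ_; _∷_; ⊆-refl; ⊆-trans) renaming (_⊆_ to _⊆ᴸ_)
open import Data.List.Relation.Binary.Sublist.Propositional.Properties using (filter-⊆; All-resp-⊆)
open import Data.List.Relation.Unary.All as All using (All; []; _∷_)
open import Data.List.Relation.Unary.All.Properties using (all-filter)
open import Data.List.Relation.Unary.Any using (Any; here; there)
open import Data.Maybe using (Maybe; just; nothing)
open import Data.Nat using (ℕ; zero; suc; _+_; _*_; _^_; _≤_; _<_; z≤n; s≤s; s≤s⁻¹; NonZero; >-nonZero) renaming (_⊔_ to max)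
open import Data.Nat.Properties
open import Data.Nat.Solver using (module +-*-Solver)
open import Data.Product using (_×_; _,_; ∃-syntax; proj₁; proj₂)
open import Data.Sum using (_⊎_; inj₁; inj₂)
open import Data.Vec using ([]; _∷_; here; there; lookup; _[_]≔_; replicate)
open import Data.Vec.Properties using (lookup⇒[]=; []=⇒lookup)
open import Function using (_∘_; _⇔_; mk⇔; Equivalence)
open import Relation.Binary.PropositionalEquality
  using (_≡_; _≢_; refl; sym; trans; cong; cong₂; subst)
open import Relation.Nullary using (¬_; contradiction; Dec; yes; no; does; Reflects; ofʸ; ofⁿ)
open import Relation.Nullary.Decidable using (_×-dec_; map′; dec-true)
open import Relation.Unary using (Pred)
open +-*-Solver using (solve; con; _:+_; _:*_) renaming (_:=_ to _⊜_)

-- A language compiled to WHILE programs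

-- A term maps an environment to a value.  Compiled, the environment lives in
-- variable zero and variable one is a stack, which is left as it was found.
-- In environment ρ, bind t u evaluates u in v ∙ ρ, where v is the value of t, and
-- fold l a t is a left fold along the list l, from a, evaluating t in h ∙ acc ∙ ρ.
data Tm : Set where
  ret  : Exp 1 → Tm
  seq  : Tm → Tm → Tm
  bind : Tm → Tm → Tm
  cond : Exp 1 → Tm → Tm → Tm
  fold : Exp 1 → Exp 1 → Tm → Tm
  loop : Tm → Tm
  prog : Program → Tm

embed : Exp 1 → Exp 2
embed (var _)    = var zero
embed nil        = nil
embed (cons e f) = cons (embed e) (embed f)
embed (hd e)     = hd (embed e)
embed (tl e)     = tl (embed e)

pattern 𝕩 = var zero
pattern 𝕤 = var (suc zero)
pattern setX e = zero := e
pattern setS e = suc zero := e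

storeᵉ : ∀ {n} → Store n → 𝔻
storeᵉ []      = nil
storeᵉ (v ∷ σ) = v ∙ storeᵉ σ

component : ∀ {n} → Fin n → Exp 2 → Exp 2
component zero    e = hd e
component (suc i) e = component i (tl e)

update : ∀ {n} → Fin n → Exp 2 → Exp 2 → Exp 2
update zero    e v = cons v (tl e)
update (suc i) e v = cons (hd e) (update i (tl e) v)

simulateExp : ∀ {n} → Exp n → Exp 2
simulateExp (var x)    = component x 𝕩
simulateExp nil        = nil
simulateExp (cons e f) = cons (simulateExp e) (simulateExp f)
simulateExp (hd e)     = hd (simulateExp e)
simulateExp (tl e)     = tl (simulateExp e)

-- The store of the simulated command is packed into a single tree.
simulate : ∀ {n} → Cmd n → Cmd 2
simulate (x := e)    = setX (update x 𝕩 (simulateExp e))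
simulate (C ⨾ D)     = simulate C ⨾ simulate D
simulate (while e C) = while (simulateExp e) (simulate C)

nils : ℕ → Exp 2
nils zero    = nil
nils (suc n) = cons nil (nils n)

-- `C` consumes the whole of variable zero, so the rest of the list and the outer environment wait
-- on the stack while it runs.
foldBody : Cmd 2 → Cmd 2
foldBody C =
  setS (cons (cons (tl (hd 𝕩)) (tl (tl 𝕩))) 𝕤) ⨾
  setX (cons (hd (hd 𝕩)) (tl 𝕩)) ⨾
  C ⨾
  setX (cons (hd (hd 𝕤)) (cons 𝕩 (tl (hd 𝕤)))) ⨾
  setS (tl 𝕤)

-- In cond, the flag pushed below the condition is reset by the first branch, and so
-- decides whether the second one is to be run.
compile : Tm → Cmd 2
compile (ret e)      = setX (embed e)
compile (seq t u)    = compile t ⨾ compile u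
compile (bind t u)   =
  setS (cons 𝕩 𝕤) ⨾ compile t ⨾ setX (cons 𝕩 (hd 𝕤)) ⨾ setS (tl 𝕤) ⨾ compile u
compile (cond e t u) =
  setS (cons (embed e) (cons (cons nil nil) 𝕤)) ⨾
  while (hd 𝕤) (setS (cons nil (cons nil (tl (tl 𝕤)))) ⨾ compile t) ⨾
  setS (tl 𝕤) ⨾
  while (hd 𝕤) (setS (cons nil (tl 𝕤)) ⨾ compile u) ⨾
  setS (tl 𝕤)
compile (fold l a t) =
  setX (cons (embed l) (cons (embed a) 𝕩)) ⨾
  while (hd 𝕩) (foldBody (compile t)) ⨾
  setX (hd (tl 𝕩))
compile (loop t)     = while (hd 𝕩) (compile t)
compile (prog P)     =
  setX (cons 𝕩 (nils extraVars)) ⨾ simulate body ⨾ setX (hd 𝕩)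
  where open Program P

-- Correctness and exact running times of compiled terms

eval₁ : Exp 1 → 𝔻 → 𝔻
eval₁ e ρ = eval e (ρ ∷ [])

eval-embed : ∀ e {ρ s} → eval (embed e) (ρ ∷ s ∷ []) ≡ eval₁ e ρ
eval-embed (var zero) = refl
eval-embed nil        = refl
eval-embed (cons e f) = cong₂ _∙_ (eval-embed e) (eval-embed f)
eval-embed (hd e)     = cong left (eval-embed e)
eval-embed (tl e)     = cong right (eval-embed e)

-- The time is fixed before the stack `s` is chosen; runs therefore nest below any pushed values
-- without affecting the count.
Run : Tm → 𝔻 → 𝔻 → ℕ → Set
Run t ρ v τ = ∀ s → ⟨ compile t , ρ ∷ s ∷ [] ⟩⇓⟨ v ∷ s ∷ [] , τ ⟩

setX-to : ∀ {n v} (e : Exp (suc n)) {x σ} → eval e (x ∷ σ) ≡ v →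
          ⟨ zero := e , x ∷ σ ⟩⇓⟨ v ∷ σ , 1 + cost e ⟩
setX-to e refl = assign

setS-to : ∀ {v} (e : Exp 2) {x s} → eval e (x ∷ s ∷ []) ≡ v →
          ⟨ setS e , x ∷ s ∷ [] ⟩⇓⟨ x ∷ v ∷ [] , 1 + cost e ⟩
setS-to e refl = assign

run-ret : ∀ e {ρ} → Run (ret e) ρ (eval₁ e ρ) (1 + cost (embed e))
run-ret e s = setX-to (embed e) (eval-embed e)

run-seq : ∀ {t u ρ v w a b} → Run t ρ v a → Run u v w b →
          Run (seq t u) ρ w (1 + a + b)
run-seq p q s = seq (p s) (q s)

run-bind : ∀ {t u ρ v w a b} → Run t ρ v a → Run u (v ∙ ρ) w b →
           Run (bind t u) ρ w (6 + (a + (10 + b)))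
run-bind {ρ = ρ} p q s =
  seq assign (seq (p (ρ ∙ s)) (seq assign (seq assign (q s))))

run-cond-nil : ∀ {e t u ρ v a} → eval₁ e ρ ≡ nil → Run u ρ v a →
               Run (cond e t u) ρ v (3 + (cost (embed e) + 5 + (18 + (a + 3 + 3))))
run-cond-nil {e} e≡nil p s =
  seq (setS-to (cons (embed e) (cons (cons nil nil) 𝕤))
         (cong (_∙ _) (trans (eval-embed e) e≡nil)))
  (seq (exit refl)
  (seq assign
  (seq (loop (λ ()) (seq assign (p (nil ∙ s))) (exit refl))
  assign)))

run-cond-∙ : ∀ {e t u ρ c d v a} → eval₁ e ρ ≡ c ∙ d → Run t ρ v a →
             Run (cond e t u) ρ v (3 + (cost (embed e) + 5 + (13 + (a + 3 + 11))))
run-cond-∙ {e} e≡∙ p s =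
  seq (setS-to (cons (embed e) (cons (cons nil nil) 𝕤))
         (cong (_∙ _) (trans (eval-embed e) e≡∙)))
  (seq (loop (λ ()) (seq assign (p (nil ∙ nil ∙ s))) (exit refl))
  (seq assign
  (seq (exit refl)
  assign)))

-- The loop of a fold apart from its initialisation, as induction on the list requires. Variable
-- zero holds the rest of the list, the accumulator and the environment.
RunFold : Tm → 𝔻 → 𝔻 → 𝔻 → 𝔻 → ℕ → Set
RunFold t ρ l a b τ = ∀ s →
  ⟨ while (hd 𝕩) (foldBody (compile t)) , (l ∙ a ∙ ρ) ∷ s ∷ [] ⟩⇓⟨ (nil ∙ b ∙ ρ) ∷ s ∷ [] , τ ⟩

run-fold-nil : ∀ {t ρ a} → RunFold t ρ nil a a 3
run-fold-nil s = exit refl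

run-fold-∙ : ∀ {t ρ h l a a′ b x y} → Run t (h ∙ a ∙ ρ) a′ x → RunFold t ρ l a′ b y →
             RunFold t ρ (h ∙ l) a b (23 + (x + 14 + y))
run-fold-∙ {ρ = ρ} {l = l} p q s =
  loop (λ ())
    (seq assign (seq assign (seq (p ((l ∙ ρ) ∙ s)) (seq assign assign))))
    (q s)

run-fold : ∀ {l a t ρ b τ} → RunFold t ρ (eval₁ l ρ) (eval₁ a ρ) b τ →
           Run (fold l a t) ρ b
             (3 + (cost (embed l) + (1 + (cost (embed a) + 1)) + (1 + (τ + 4))))
run-fold {l} {a} p s =
  seq (setX-to (cons (embed l) (cons (embed a) 𝕩))
         (cong₂ _∙_ (eval-embed l) (cong (_∙ _) (eval-embed a))))
  (seq (p s) assign)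

run-loop-exit : ∀ {t ρ} → Run (loop t) (nil ∙ ρ) (nil ∙ ρ) 3
run-loop-exit s = exit refl

run-loop-again : ∀ {t h l ρ σ τ x y} → Run t ((h ∙ l) ∙ ρ) σ x → Run (loop t) σ τ y →
                 Run (loop t) ((h ∙ l) ∙ ρ) τ (3 + (x + y))
run-loop-again p q s = loop (λ ()) (p s) (q s)

-- Simulation of arbitrary WHILE programs

eval-component : ∀ {n} (i : Fin n) (σ : Store n) e {ρ} → eval e ρ ≡ storeᵉ σ →
                 eval (component i e) ρ ≡ lookup σ i
eval-component zero    (v ∷ σ) e eq = cong left eq
eval-component (suc i) (v ∷ σ) e eq = eval-component i σ (tl e) (cong right eq)

eval-simulate : ∀ {n} (e : Exp n) (σ : Store n) {s} →
                eval (simulateExp e) (storeᵉ σ ∷ s ∷ []) ≡ eval e σ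
eval-simulate (var x)    σ = eval-component x σ 𝕩 refl
eval-simulate nil        σ = refl
eval-simulate (cons e f) σ = cong₂ _∙_ (eval-simulate e σ) (eval-simulate f σ)
eval-simulate (hd e)     σ = cong left (eval-simulate e σ)
eval-simulate (tl e)     σ = cong right (eval-simulate e σ)

eval-update : ∀ {n} (i : Fin n) (σ : Store n) e f {ρ v} →
              eval e ρ ≡ storeᵉ σ → eval f ρ ≡ v →
              eval (update i e f) ρ ≡ storeᵉ (σ [ i ]≔ v)
eval-update zero    (_ ∷ σ) e f eq eq′ = cong₂ _∙_ eq′ (cong right eq)
eval-update (suc i) (_ ∷ σ) e f eq eq′ =
  cong₂ _∙_ (cong left eq) (eval-update i σ (tl e) f (cong right eq) eq′)

-- The new time is left unspecified: simulated programs serve only to compute the time bound, where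
-- termination suffices.
run-simulate : ∀ {n} {C : Cmd n} {σ τ t} → ⟨ C , σ ⟩⇓⟨ τ , t ⟩ → ∃[ t′ ] ∀ s →
               ⟨ simulate C , storeᵉ σ ∷ s ∷ [] ⟩⇓⟨ storeᵉ τ ∷ s ∷ [] , t′ ⟩
run-simulate (assign {x} {e} {σ}) =
  _ , λ s → setX-to (update x 𝕩 (simulateExp e))
              (eval-update x σ 𝕩 (simulateExp e) refl (eval-simulate e σ))
run-simulate (seq p q) with _ , p′ ← run-simulate p | _ , q′ ← run-simulate q =
  _ , λ s → seq (p′ s) (q′ s)
run-simulate (exit {e} {C} {σ} e≡nil) =
  _ , λ s → exit (trans (eval-simulate e σ) e≡nil)
run-simulate (loop {e} {C} {ρ} e≢nil p q) with _ , p′ ← run-simulate p | _ , q′ ← run-simulate q =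
  _ , λ s → loop (e≢nil ∘ trans (sym (eval-simulate e ρ))) (p′ s) (q′ s)

eval-nils : ∀ n {σ} → eval (nils n) σ ≡ storeᵉ (replicate n nil)
eval-nils zero    = refl
eval-nils (suc n) = cong (nil ∙_) (eval-nils n)

-- Running times

-- If all lists folded over have length at most B, and loops are iterated at most
-- B times, then t takes time at most B ^ exponent t.  The value at prog is junk: prog
-- occurs only where running times do not matter.
exponent : Tm → ℕ
exponent (ret e)      = 1 + cost (embed e)
exponent (seq t u)    = 2 + (1 + exponent t + exponent u)
exponent (bind t u)   = 7 + (1 + exponent t + (11 + exponent u))
exponent (cond e t u) =
  36 + (1 + cost (embed e) + (1 + exponent t + exponent u))
exponent (fold l a t) =
  1 + (10 + cost (embed l) + cost (embed a)) + (1 + (39 + exponent t) + 3)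
exponent (loop t)     = 1 + (1 + (4 + exponent t)) + 3
exponent (prog P)     = 0

module Timed {B : ℕ} (2≤B : 2 ≤ B) where

  instance
    B≢0 : NonZero B
    B≢0 = >-nonZero (≤-trans (s≤s z≤n) 2≤B)

  -- A record, so that x and m can be inferred from x ≼ m.
  infix 4 _≼_
  record _≼_ (x m : ℕ) : Set where
    constructor ≤⇒≼
    field ≼⇒≤ : x ≤ B ^ m
  open _≼_

  ≤-≼-trans : ∀ {x y m} → x ≤ y → y ≼ m → x ≼ m
  ≤-≼-trans x≤y (≤⇒≼ y≤) = ≤⇒≼ (≤-trans x≤y y≤)

  ≼-weaken : ∀ {x m n} → m ≤ n → x ≼ m → x ≼ n
  ≼-weaken m≤n (≤⇒≼ x≤) = ≤⇒≼ (≤-trans x≤ (^-monoʳ-≤ B m≤n))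

  -- Both summands are at most `B ^ (m + n)`, and the resulting factor 2 is absorbed by one more
  -- factor `B`.
  ≼-+ : ∀ {x y m n} → x ≼ m → y ≼ n → x + y ≼ 1 + m + n
  ≼-+ {x} {y} {m} {n} (≤⇒≼ x≤) (≤⇒≼ y≤) = ≤⇒≼ (begin
    x + y                      ≤⟨ +-mono-≤ x≤ y≤ ⟩
    B ^ m + B ^ n              ≤⟨ +-mono-≤ (^-monoʳ-≤ B (m≤m+n m n)) (^-monoʳ-≤ B (m≤n+m n m)) ⟩
    B ^ (m + n) + B ^ (m + n)  ≡⟨ cong (B ^ (m + n) +_) (+-identityʳ _) ⟨
    2 * B ^ (m + n)            ≤⟨ *-monoˡ-≤ (B ^ (m + n)) 2≤B ⟩
    B ^ (1 + m + n)            ∎)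
    where open ≤-Reasoning

  ≼-* : ∀ {x y m n} → x ≼ m → y ≼ n → x * y ≼ m + n
  ≼-* {m = m} {n} (≤⇒≼ x≤) (≤⇒≼ y≤) =
    ≤⇒≼ (≤-trans (*-mono-≤ x≤ y≤) (≤-reflexive (sym (^-distribˡ-+-* B m n))))

  -- Turns constant costs into exponents.
  ≼-refl : ∀ c → c ≼ c
  ≼-refl c = ≤⇒≼ (n≤B^n c)
    where
    open ≤-Reasoning
    n≤B^n : ∀ n → n ≤ B ^ n
    n≤B^n zero    = z≤n
    n≤B^n (suc n) = begin
      1 + n          ≤⟨ +-mono-≤ (m^n>0 B n) (n≤B^n n) ⟩
      B ^ n + B ^ n  ≡⟨ cong (B ^ n +_) (+-identityʳ _) ⟨
      2 * B ^ n      ≤⟨ *-monoˡ-≤ (B ^ n) 2≤B ⟩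
      B ^ suc n      ∎

  ≤B⇒≼ : ∀ {m} → m ≤ B → m ≼ 1
  ≤B⇒≼ m≤B = ≤⇒≼ (≤-trans m≤B (≤-reflexive (sym (^-identityʳ B))))

  -- The exponent depends on the term alone and not on the data; for the whole search it becomes the
  -- constant exponent in the definition of fixed-parameter tractability.
  infix 4 _⊢_⇒_
  record _⊢_⇒_ (t : Tm) (ρ v : 𝔻) : Set where
    constructor within
    field
      {time} : ℕ
      run    : Run t ρ v time
      bound  : time ≼ exponent t

  ⇒-ret : ∀ {e ρ v} → eval₁ e ρ ≡ v → ret e ⊢ ρ ⇒ v
  ⇒-ret {e} refl = within (run-ret e) (≼-refl (1 + cost (embed e)))

  ⇒-seq : ∀ {t u ρ v w} → t ⊢ ρ ⇒ v → u ⊢ v ⇒ w → seq t u ⊢ ρ ⇒ w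
  ⇒-seq {t} {u} (within p a) (within q b) =
    within (run-seq {t} {u} p q) (≼-+ (≼-refl 1) (≼-+ a b))

  ⇒-bind : ∀ {t u ρ v w} → t ⊢ ρ ⇒ v → u ⊢ v ∙ ρ ⇒ w → bind t u ⊢ ρ ⇒ w
  ⇒-bind {t} {u} (within p a) (within q b) =
    within (run-bind {t} {u} p q)
      (≼-+ (≼-refl 6) (≼-+ a (≼-+ (≼-refl 10) b)))

  ⇒-cond-nil : ∀ {e t u ρ v} → eval₁ e ρ ≡ nil → u ⊢ ρ ⇒ v → cond e t u ⊢ ρ ⇒ v
  ⇒-cond-nil {e} {t} {u} eq (within {a} p b) =
    within (run-cond-nil {e} {t} {u} eq p)
      -- Padding by 3 gives both branches the overhead 35, so that one exponent serves for either.
      (≤-≼-trans (≤-trans (m≤m+n _ 3) (≤-reflexive (solve 2 (λ c a →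
          con 3 :+ (c :+ con 5 :+ (con 18 :+ (a :+ con 3 :+ con 3))) :+ con 3 ⊜
          con 35 :+ (c :+ a)) refl (cost (embed e)) a)))
        (≼-+ (≼-refl 35) (≼-+ (≼-refl (cost (embed e)))
          (≼-weaken (m≤n+m (exponent u) (1 + exponent t)) b))))

  ⇒-cond-∙ : ∀ {e t u ρ c d v} → eval₁ e ρ ≡ c ∙ d → t ⊢ ρ ⇒ v → cond e t u ⊢ ρ ⇒ v
  ⇒-cond-∙ {e} {t} {u} eq (within {a} p b) =
    within (run-cond-∙ {e} {t} {u} eq p)
      (≤-≼-trans (≤-reflexive (solve 2 (λ c a →
          con 3 :+ (c :+ con 5 :+ (con 13 :+ (a :+ con 3 :+ con 11))) ⊜
          con 35 :+ (c :+ a)) refl (cost (embed e)) a))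
        (≼-+ (≼-refl 35) (≼-+ (≼-refl (cost (embed e)))
          (≼-weaken (≤-trans (m≤m+n (exponent t) (exponent u)) (n≤1+n _)) b))))

  infixr 5 _∷_
  data Fold (t : Tm) (ρ : 𝔻) : ℕ → 𝔻 → 𝔻 → 𝔻 → Set where
    []  : ∀ {a} → Fold t ρ 0 nil a a
    _∷_ : ∀ {m h l a a′ b} → t ⊢ h ∙ a ∙ ρ ⇒ a′ → Fold t ρ m l a′ b →
          Fold t ρ (suc m) (h ∙ l) a b

  -- Each of the `m` iterations costs the body and an overhead of 37; the last 3 pays for the
  -- failing test.
  run-Fold : ∀ {t ρ m l a b} → Fold t ρ m l a b →
             ∃[ τ ] RunFold t ρ l a b τ × τ ≤ m * (23 + (B ^ exponent t + 14)) + 3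
  run-Fold {t} {ρ} [] = 3 , run-fold-nil {t} {ρ} , ≤-refl
  run-Fold {t} {ρ} {suc m} (_∷_ {h = h} {l} {a} {a′} {b} (within {x} p x≤) ps)
    with τ , q , τ≤ ← run-Fold ps =
    23 + (x + 14 + τ) , run-fold-∙ {t} {ρ} {h} {l} {a} {a′} {b} {x} {τ} p q , (begin
      23 + (x + 14 + τ)          ≡⟨ +-assoc 23 (x + 14) τ ⟨
      23 + (x + 14) + τ          ≤⟨ +-mono-≤ (+-monoʳ-≤ 23 (+-monoˡ-≤ 14 (≼⇒≤ x≤))) τ≤ ⟩
      K + (m * K + 3)            ≡⟨ +-assoc K (m * K) 3 ⟨
      suc m * K + 3              ∎)
    where
    open ≤-Reasoning
    K = 23 + (B ^ exponent t + 14)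

  ⇒-fold : ∀ {e f t ρ m l a b} → m ≤ B → eval₁ e ρ ≡ l → eval₁ f ρ ≡ a →
           Fold t ρ m l a b → fold e f t ⊢ ρ ⇒ b
  ⇒-fold {e} {f} {t} {ρ} {m} {b = b} m≤B refl refl ps with τ , p , τ≤ ← run-Fold ps =
    within (run-fold {e} {f} {t} {ρ} {b} {τ} p)
      (≤-≼-trans (≤-reflexive (solve 3 (λ c d τ →
          con 3 :+ (c :+ (con 1 :+ (d :+ con 1)) :+ (con 1 :+ (τ :+ con 4))) ⊜
          con 10 :+ c :+ d :+ τ) refl c d τ))
      (≼-+ (≼-refl (10 + c + d))
      (≤-≼-trans τ≤
      (≼-+ (≼-* (≤B⇒≼ m≤B) K-bound) (≼-refl 3)))))
    where
    c = cost (embed e)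
    d = cost (embed f)
    K-bound : 23 + (B ^ exponent t + 14) ≼ 38 + exponent t
    K-bound = ≤-≼-trans
      (≤-reflexive (solve 1 (λ x → con 23 :+ (x :+ con 14) ⊜ con 37 :+ x) refl (B ^ exponent t)))
      (≼-+ (≼-refl 37) (≤⇒≼ ≤-refl))

  -- The index counts iterations. Unlike for folds no list bounds it in advance; for `exploreT` the
  -- bound comes from the search tree.
  data While (t : Tm) : ℕ → 𝔻 → 𝔻 → Set where
    exit  : ∀ {ρ} → While t 0 (nil ∙ ρ) (nil ∙ ρ)
    again : ∀ {m h l ρ σ τ} → t ⊢ (h ∙ l) ∙ ρ ⇒ σ → While t m σ τ →
            While t (suc m) ((h ∙ l) ∙ ρ) τ

  run-While : ∀ {t m ρ σ} → While t m ρ σ →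
              ∃[ τ ] Run (loop t) ρ σ τ × τ ≤ m * (3 + B ^ exponent t) + 3
  run-While {t} (exit {ρ}) = 3 , run-loop-exit {t} {ρ} , ≤-refl
  run-While {t} {suc m} (again {h = h} {l} {ρ} {σ} {ρ′} (within {x} p x≤) ps)
    with τ , q , τ≤ ← run-While ps =
    3 + (x + τ) , run-loop-again {t} {h} {l} {ρ} {σ} {ρ′} {x} {τ} p q , (begin
      3 + (x + τ)                ≡⟨ +-assoc 3 x τ ⟨
      3 + x + τ                  ≤⟨ +-mono-≤ (+-monoʳ-≤ 3 (≼⇒≤ x≤)) τ≤ ⟩
      K + (m * K + 3)            ≡⟨ +-assoc K (m * K) 3 ⟨
      suc m * K + 3              ∎)
    where
    open ≤-Reasoning
    K = 3 + B ^ exponent t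

  ⇒-loop : ∀ {t m ρ σ} → m ≤ B → While t m ρ σ → loop t ⊢ ρ ⇒ σ
  ⇒-loop {t} {m} m≤B ps with τ , p , τ≤ ← run-While ps =
    within p (≤-≼-trans τ≤
      (≼-+ (≼-* (≤B⇒≼ m≤B) (≼-+ (≼-refl 3) (≤⇒≼ ≤-refl))) (≼-refl 3)))

-- The search program

tails : ℕ → Exp 1
tails zero    = var zero
tails (suc i) = tl (tails i)

-- The de Bruijn index i.
infix 8 #_
#_ : ℕ → Exp 1
# i = hd (tails i)

yes′ : Exp 1
yes′ = cons nil nil

call₁ : Tm → Exp 1 → Tm
call₁ t e = seq (ret (cons e nil)) t

call₂ : Tm → Exp 1 → Exp 1 → Tm
call₂ t e f = seq (ret (cons e (cons f nil))) t

reverseT : Exp 1 → Tm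
reverseT e = fold e nil (ret (cons (# 0) (# 1)))

-- The accumulator pairs the unread part of the second list with the pairs formed so far; these come
-- in reverse order, hence the final `reverseT`.
zipStep zipT : Tm
zipStep = ret (cons (tl (hd (# 1))) (cons (cons (# 0) (hd (hd (# 1)))) (tl (# 1))))
zipT    = bind (fold (# 0) (cons (# 1) nil) zipStep) (reverseT (tl (# 0)))

mapStep : Tm → Tm
mapStep t = bind t (ret (cons (# 0) (# 2)))

mapT : Exp 1 → Tm → Tm
mapT e t = bind (fold e nil (mapStep t)) (reverseT (# 0))

anyStep : Tm → Tm
anyStep t = bind t (cond (# 0) (ret yes′) (ret (# 2)))

anyT : Exp 1 → Tm → Tm
anyT e t = fold e nil (anyStep t)

andT meetT escapeT : Tm
andT    = bind zipT (mapT (# 0) (cond (hd (# 0)) (ret (tl (# 0))) (ret nil)))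
meetT   = bind zipT (anyT (# 0) (cond (hd (# 0)) (ret (tl (# 0))) (ret nil)))
escapeT = bind zipT (anyT (# 0)
  (cond (hd (# 0)) (cond (tl (# 0)) (ret nil) (ret yes′)) (ret nil)))

-- The accumulator after i steps is a list of i zeros, followed by the i × i identity matrix.
identityStep identityT : Tm
identityStep = bind (mapT (tl (# 1)) (ret (cons nil (# 0))))
  (ret (cons (cons nil (hd (# 2))) (cons (cons yes′ (hd (# 2))) (# 0))))
identityT    = seq (fold (# 0) (cons nil nil) identityStep) (ret (tl (tails 0)))

growT : Tm
growT = bind zipT
  (mapT (# 0)
    (bind (call₂ zipT (tl (# 0)) (# 4))
      (mapT (# 0) (cond (hd (# 0)) (ret yes′) (call₂ meetT (hd (# 3)) (tl (# 0)))))))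

growStep ballsT : Tm
growStep = call₂ growT (# 3) (# 1)
ballsT   = bind (call₁ identityT (# 0)) (fold (# 2) (# 0) growStep)

-- From here to exploreT, environments end in stack ∙ answer ∙ rows ∙ identity matrix: the
-- top of the stack is the node under consideration, and rows pairs W with the d-balls.
coveredT : Tm
coveredT = anyT (hd (# 2))
  (bind (call₂ escapeT (# 0) (tl (# 2))) (cond (# 0) (ret nil) (ret yes′)))

selectStep selectT : Tm
selectStep = cond (hd (# 0))
  (bind coveredT (cond (# 0) (ret (# 2)) (ret (cons nil (tl (# 1))))))
  (ret (# 1))
selectT    = fold (# 2) nil selectStep

-- The index of the set to be intersected is given as a row of the identity matrix, so that zip and
-- map replace access by position.
childT : Tm
childT = bind (call₂ zipT (hd (# 1)) (hd (# 5)))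
  (mapT (# 0) (cond (hd (# 0)) (call₂ andT (tl (# 0)) (tl (# 7))) (ret (tl (# 0)))))

-- Children with an empty candidate set are discarded here, which keeps all sets on the stack
-- non-empty.
pushT : Tm
pushT = bind (call₂ meetT (tl (# 0)) (tl (# 3)))
  (cond (# 0) (bind childT (ret (cons (# 0) (# 3)))) (ret (# 2)))

exploreT : Tm
exploreT = bind selectT
  (cond (# 0)
    (bind (call₂ zipT (# 4) (hd (# 1)))
      (bind (fold (# 0) (tl (# 2)) pushT) (ret (cons (# 0) (tails 4)))))
    -- No vertex is left to branch on: the answer is yes, and emptying the stack ends the loop.
    (ret (cons nil (cons yes′ (tails 3)))))

searchT : Tm
searchT =
  -- The input ends in `d` itself; repacking it with a final `nil` makes `d` accessible by an index
  -- like the other components.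
  seq (ret (cons (# 0) (cons (# 1) (cons (# 2) (cons (tails 3) nil)))))
  (bind (call₂ ballsT (# 0) (# 3))
  (bind (call₂ zipT (# 2) (# 0))
  (bind (call₁ identityT (# 4))
  (bind (mapT (# 3) (ret yes′))
  (bind (mapT (# 6) (ret (# 2)))
  -- The test k ≤ n: a list of length n + 1, made from the rows of the adjacency matrix, survives
  -- the removal of k entries exactly in this case.
  (bind (fold (# 7) (cons nil (# 5)) (ret (tl (# 1))))
  (cond (# 0)
    (seq (ret (cons (cons (# 1) nil) (cons nil (cons (# 4) (cons (# 3) nil)))))
    (seq (loop exploreT) (ret (# 1))))
    (ret nil))))))))

-- Tables as trees, and the functions computed by the search program

tab : ∀ n → (Fin n → 𝔻) → 𝔻
tab zero    f = nil
tab (suc n) f = f zero ∙ tab n (f ∘ suc)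

tab-cong : ∀ n {f g : Fin n → 𝔻} → (∀ i → f i ≡ g i) → tab n f ≡ tab n g
tab-cong zero    eq = refl
tab-cong (suc n) eq = cong₂ _∙_ (eq zero) (tab-cong n (eq ∘ suc))

bits : ∀ {n} → (Fin n → Bool) → 𝔻
bits {n} p = tab n (bool ∘ p)

Matrix : ℕ → ℕ → Set
Matrix m n = Fin m → Fin n → Bool

matrix : ∀ {m n} → Matrix m n → 𝔻
matrix {m} M = tab m λ i → bits (M i)

len : 𝔻 → ℕ
len nil     = 0
len (_ ∙ l) = suc (len l)

append reverseOnto : 𝔻 → 𝔻 → 𝔻
append nil     o = o
append (h ∙ l) o = h ∙ append l o
reverseOnto nil     o = o
reverseOnto (h ∙ l) o = reverseOnto l (h ∙ o)

append-nil : ∀ l → append l nil ≡ l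
append-nil nil     = refl
append-nil (h ∙ l) = cong (h ∙_) (append-nil l)

reverseOnto-involutive : ∀ l o {k} → reverseOnto (reverseOnto l o) k ≡ reverseOnto o (append l k)
reverseOnto-involutive nil     o = refl
reverseOnto-involutive (h ∙ l) o = reverseOnto-involutive l (h ∙ o)

reverse-involutive : ∀ l → reverseOnto (reverseOnto l nil) nil ≡ l
reverse-involutive l = trans (reverseOnto-involutive l nil) (append-nil l)

len-reverseOnto : ∀ l o → len (reverseOnto l o) ≡ len l + len o
len-reverseOnto nil     o = refl
len-reverseOnto (h ∙ l) o = trans (len-reverseOnto l (h ∙ o)) (+-suc (len l) (len o))

len-tab : ∀ n f → len (tab n f) ≡ n
len-tab zero    f = refl
len-tab (suc n) f = cong suc (len-tab n (f ∘ suc))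

some : ∀ n → (Fin n → Bool) → Bool
some zero    p = false
some (suc n) p = p zero ∨ some n (p ∘ suc)

identity : ∀ n → Matrix n n
identity (suc n) zero    zero    = true
identity (suc n) zero    (suc j) = false
identity (suc n) (suc i) zero    = false
identity (suc n) (suc i) (suc j) = identity n i j

-- One step of breadth-first search from all vertices at once. Reading `M w v` in place of `M v w`
-- makes both factors rows; distances being symmetric, the result is the same for balls.
grow : ∀ {n} → Matrix n n → Matrix n n → Matrix n n
grow {n} A M u w = M u w ∨ some n λ v → A u v ∧ M w v

balls : ∀ {n} → Matrix n n → ℕ → Matrix n n
balls {n} A zero    = identity n
balls     A (suc d) = grow A (balls A d)

-- Follows the left fold of the program, so the last index satisfying `p` wins.
choose : ∀ {A : Set} n → (Fin n → Bool) → (Fin n → A) → Maybe A → Maybe A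
choose zero    p f c = c
choose (suc n) p f c = choose n (p ∘ suc) (f ∘ suc) (if p zero then just (f zero) else c)

keepIf : ∀ {A : Set} n → (Fin n → Bool) → (Fin n → A) → List A → List A
keepIf zero    p f c = c
keepIf (suc n) p f c = keepIf n (p ∘ suc) (f ∘ suc) (if p zero then f zero ∷ c else c)

-- For vertex sets a and b given by bits: a ∩ b is non-empty, and a is not contained in b.
meets escapes : ∀ {n} → (Fin n → Bool) → (Fin n → Bool) → Bool
meets   {n} a b = some n λ i → a i ∧ b i
escapes {n} a b = some n λ i → a i ∧ not (b i)

-- Some candidate set lies inside the ball `row`, so whichever of its elements is chosen will
-- dominate the centre.
covered : ∀ {k n} → Matrix k n → (Fin n → Bool) → Bool
covered {k} st row = some k λ j → not (escapes (st j) row)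

child : ∀ {k n} → Matrix k n → (Fin n → Bool) → Fin k → Matrix k n
child {k} st row i j v = if identity k i j then st j v ∧ row v else st j v

select : ∀ {k n} → Matrix n n → (Fin n → Bool) → Matrix k n → Maybe (Fin n)
select {n = n} M W st = choose n (λ u → W u ∧ not (covered st (M u))) (λ u → u) nothing

push : ∀ {k n} → Matrix k n → (Fin n → Bool) → List (Matrix k n) → List (Matrix k n)
push {k} st row = keepIf k (λ i → meets (st i) row) (child st row)

-- Correctness and running time of the parts of the search program

module Programs {B : ℕ} (2≤B : 2 ≤ B) where
  open Timed 2≤B

  ⇒-≡ : ∀ {t ρ v w} → t ⊢ ρ ⇒ v → v ≡ w → t ⊢ ρ ⇒ w
  ⇒-≡ p refl = p

  ⇒-if : ∀ {e t u ρ v w} b → eval₁ e ρ ≡ bool b → t ⊢ ρ ⇒ v → u ⊢ ρ ⇒ w →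
         cond e t u ⊢ ρ ⇒ (if b then v else w)
  ⇒-if true  eq p q = ⇒-cond-∙ eq p
  ⇒-if false eq p q = ⇒-cond-nil eq q

  ⇒-call₁ : ∀ {t e ρ v} → t ⊢ eval₁ e ρ ∙ nil ⇒ v → call₁ t e ⊢ ρ ⇒ v
  ⇒-call₁ p = ⇒-seq (⇒-ret refl) p

  ⇒-call₂ : ∀ {t e f ρ v} → t ⊢ eval₁ e ρ ∙ eval₁ f ρ ∙ nil ⇒ v → call₂ t e f ⊢ ρ ⇒ v
  ⇒-call₂ p = ⇒-seq (⇒-ret refl) p

  reverse-fold : ∀ {ρ} l o → Fold (ret (cons (# 0) (# 1))) ρ (len l) l o (reverseOnto l o)
  reverse-fold nil     o = []
  reverse-fold (h ∙ l) o = ⇒-ret refl ∷ reverse-fold l (h ∙ o)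

  ⇒-reverse : ∀ {e ρ n f} → n ≤ B → eval₁ e ρ ≡ reverseOnto (tab n f) nil →
              reverseT e ⊢ ρ ⇒ tab n f
  ⇒-reverse {n = n} {f} n≤B eq =
    ⇒-≡ (⇒-fold len≤B eq refl (reverse-fold (reverseOnto (tab n f) nil) nil))
        (reverse-involutive (tab n f))
    where
    len≤B : len (reverseOnto (tab n f) nil) ≤ B
    len≤B = ≤-trans (≤-reflexive (trans (len-reverseOnto (tab n f) nil)
      (trans (+-identityʳ _) (len-tab n f)))) n≤B

  ⇒-zip : ∀ {ρ} n {f g} → n ≤ B → zipT ⊢ tab n f ∙ tab n g ∙ ρ ⇒ tab n λ i → f i ∙ g i
  ⇒-zip {ρ} n n≤B =
    ⇒-bind (⇒-fold n≤B refl refl (steps n _ _ nil)) (⇒-reverse n≤B refl)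
    where
    steps : ∀ {ρ} n f g o → Fold zipStep ρ n (tab n f) (tab n g ∙ o)
                              (nil ∙ reverseOnto (tab n λ i → f i ∙ g i) o)
    steps zero    f g o = []
    steps (suc n) f g o = ⇒-ret refl ∷ steps n (f ∘ suc) (g ∘ suc) _

  ⇒-map : ∀ {e t ρ} n {f g} → n ≤ B → eval₁ e ρ ≡ tab n f →
          (∀ i {a} → t ⊢ f i ∙ a ∙ ρ ⇒ g i) → mapT e t ⊢ ρ ⇒ tab n g
  ⇒-map {e} {t} {ρ} n n≤B eq body =
    ⇒-bind (⇒-fold n≤B eq refl (steps n nil body)) (⇒-reverse n≤B refl)
    where
    steps : ∀ n {f g} o → (∀ i {a} → t ⊢ f i ∙ a ∙ ρ ⇒ g i) →
            Fold (mapStep t) ρ n (tab n f) o (reverseOnto (tab n g) o)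
    steps zero    o body = []
    steps (suc n) o body =
      ⇒-bind (body zero) (⇒-ret refl) ∷ steps n _ (body ∘ suc)

  ⇒-any : ∀ {e t ρ} n {f} {p : Fin n → Bool} → n ≤ B → eval₁ e ρ ≡ tab n f →
          (∀ i {a} → t ⊢ f i ∙ a ∙ ρ ⇒ bool (p i)) → anyT e t ⊢ ρ ⇒ bool (some n p)
  ⇒-any {e} {t} {ρ} n {p = p} n≤B eq body =
    ⇒-≡ (⇒-fold n≤B eq refl (steps n false body)) (cong bool (∨-identityʳ (some n p)))
    where
    absorb : ∀ b c d → d ∨ (if b then true else c) ≡ (b ∨ d) ∨ c
    absorb true  c d = ∨-zeroʳ d
    absorb false c d = refl
    if-bool : ∀ b c → (if b then bool true else bool c) ≡ bool (if b then true else c)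
    if-bool true  c = refl
    if-bool false c = refl
    steps : ∀ n {f} {p : Fin n → Bool} c → (∀ i {a} → t ⊢ f i ∙ a ∙ ρ ⇒ bool (p i)) →
            Fold (anyStep t) ρ n (tab n f) (bool c) (bool (some n p ∨ c))
    steps zero    c body = []
    steps (suc n) {f} {p} c body =
      subst (Fold (anyStep t) ρ (suc n) (tab (suc n) f) (bool c) ∘ bool)
        (absorb (p zero) c (some n (p ∘ suc)))
        (⇒-bind (body zero)
          (⇒-≡ (⇒-if (p zero) refl (⇒-ret refl) (⇒-ret refl)) (if-bool (p zero) c))
         ∷ steps n (if p zero then true else c) (body ∘ suc))

  ⇒-∧ : ∀ b c {ρ} → cond (hd (# 0)) (ret (tl (# 0))) (ret nil) ⊢ (bool b ∙ bool c) ∙ ρ ⇒ bool (b ∧ c)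
  ⇒-∧ true  c = ⇒-cond-∙ refl (⇒-ret refl)
  ⇒-∧ false c = ⇒-cond-nil refl (⇒-ret refl)

  ⇒-∧-not : ∀ b c {ρ} → cond (hd (# 0)) (cond (tl (# 0)) (ret nil) (ret yes′)) (ret nil)
                          ⊢ (bool b ∙ bool c) ∙ ρ ⇒ bool (b ∧ not c)
  ⇒-∧-not true  true  = ⇒-cond-∙ refl (⇒-cond-∙ refl (⇒-ret refl))
  ⇒-∧-not true  false = ⇒-cond-∙ refl (⇒-cond-nil refl (⇒-ret refl))
  ⇒-∧-not false c     = ⇒-cond-nil refl (⇒-ret refl)

  ⇒-not : ∀ b {ρ} → cond (# 0) (ret nil) (ret yes′) ⊢ bool b ∙ ρ ⇒ bool (not b)
  ⇒-not true  = ⇒-cond-∙ refl (⇒-ret refl)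
  ⇒-not false = ⇒-cond-nil refl (⇒-ret refl)

  module _ {n : ℕ} (n≤B : n ≤ B) where

    ⇒-and : ∀ (a b : Fin n → Bool) {ρ} → andT ⊢ bits a ∙ bits b ∙ ρ ⇒ bits λ i → a i ∧ b i
    ⇒-and a b = ⇒-bind (⇒-zip n n≤B) (⇒-map n n≤B refl λ i → ⇒-∧ (a i) (b i))

    ⇒-meets : ∀ (a b : Fin n → Bool) {ρ} → meetT ⊢ bits a ∙ bits b ∙ ρ ⇒ bool (meets a b)
    ⇒-meets a b = ⇒-bind (⇒-zip n n≤B) (⇒-any n n≤B refl λ i → ⇒-∧ (a i) (b i))

    ⇒-escapes : ∀ (a b : Fin n → Bool) {ρ} → escapeT ⊢ bits a ∙ bits b ∙ ρ ⇒ bool (escapes a b)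
    ⇒-escapes a b = ⇒-bind (⇒-zip n n≤B) (⇒-any n n≤B refl λ i → ⇒-∧-not (a i) (b i))

  ⇒-identity : ∀ n {f ρ} → n ≤ B → identityT ⊢ tab n f ∙ ρ ⇒ matrix (identity n)
  ⇒-identity n n≤B = ⇒-seq
    (⇒-≡ (⇒-fold n≤B refl refl (steps n 0 (≤-trans (≤-reflexive (+-identityʳ n)) n≤B)))
         (cong state (+-identityʳ n)))
    (⇒-ret refl)
    where
    state : ℕ → 𝔻
    state m = tab m (λ _ → nil) ∙ matrix (identity m)
    steps : ∀ {ρ} n m {f} → n + m ≤ B → Fold identityStep ρ n (tab n f) (state m) (state (n + m))
    steps zero    m n+m≤B = []
    steps {ρ} (suc n) m {f} n+m≤B =
      ⇒-bind (⇒-map m (≤-trans (m≤n+m m (suc n)) n+m≤B) refl λ i → ⇒-ret refl) (⇒-ret refl)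
      ∷ subst (Fold identityStep ρ n (tab n (f ∘ suc)) (state (suc m)) ∘ state) (+-suc n m)
          (steps n (suc m) (≤-trans (≤-reflexive (+-suc n m)) n+m≤B))

  module _ {n : ℕ} (n≤B : n ≤ B) (A : Matrix n n) where

    ⇒-grow : ∀ (M : Matrix n n) {ρ} → growT ⊢ matrix A ∙ matrix M ∙ ρ ⇒ matrix (grow A M)
    ⇒-grow M = ⇒-bind (⇒-zip n n≤B)
      (⇒-map n n≤B refl λ u →
        ⇒-bind (⇒-call₂ (⇒-zip n n≤B))
          (⇒-map n n≤B refl λ w → cell u w))
      where
      cell : ∀ u w {a z b ρ} →
             cond (hd (# 0)) (ret yes′) (call₂ meetT (hd (# 3)) (tl (# 0)))
               ⊢ (bool (M u w) ∙ bits (M w)) ∙ a ∙ z ∙ (bits (A u) ∙ b) ∙ ρ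
               ⇒ bool (grow A M u w)
      cell u w with M u w
      ... | true  = ⇒-cond-∙ refl (⇒-ret refl)
      ... | false = ⇒-cond-nil refl (⇒-call₂ (⇒-meets n≤B (A u) (M w)))

    ⇒-balls : ∀ d → d ≤ B → ballsT ⊢ matrix A ∙ num d ∙ nil ⇒ matrix (balls A d)
    ⇒-balls d d≤B =
      ⇒-bind (⇒-call₁ (⇒-identity n n≤B))
        (⇒-≡ (⇒-fold d≤B refl refl (steps d 0))
             (cong (λ i → matrix (balls A i)) (+-identityʳ d)))
      where
      steps : ∀ {I ρ} d i → Fold growStep (I ∙ matrix A ∙ ρ) d (num d)
                              (matrix (balls A i)) (matrix (balls A (d + i)))
      steps zero    i = []
      steps {I} {ρ} (suc d) i = ⇒-call₂ (⇒-grow (balls A i)) ∷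
        subst (λ j → Fold growStep (I ∙ matrix A ∙ ρ) d (num d)
                       (matrix (balls A (suc i))) (matrix (balls A j)))
          (+-suc d i) (steps d (suc i))

  module Explore {n k : ℕ} (n≤B : n ≤ B) (k≤B : k ≤ B)
                 (M : Matrix n n) (W : Fin n → Bool) where

    rows : 𝔻
    rows = tab n λ u → bool (W u) ∙ bits (M u)

    -- Only the ball around the chosen vertex is kept, since branching does not use its name.
    chosen : Maybe (Fin n) → 𝔻
    chosen nothing  = nil
    chosen (just u) = nil ∙ bits (M u)

    ⇒-covered : ∀ (st : Matrix k n) row {b a l ρ} →
                coveredT ⊢ (b ∙ bits row) ∙ a ∙ (matrix st ∙ l) ∙ ρ ⇒ bool (covered st row)
    ⇒-covered st row = ⇒-any k k≤B refl λ j →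
      ⇒-bind (⇒-call₂ (⇒-escapes n≤B (st j) row)) (⇒-not (escapes (st j) row))

    ⇒-selectStep : ∀ (st : Matrix k n) u c {l ρ} →
      selectStep ⊢ (bool (W u) ∙ bits (M u)) ∙ chosen c ∙ (matrix st ∙ l) ∙ ρ
                 ⇒ chosen (if W u ∧ not (covered st (M u)) then just u else c)
    ⇒-selectStep st u c with W u
    ... | false = ⇒-cond-nil refl (⇒-ret refl)
    ... | true  = ⇒-cond-∙ refl (⇒-bind (⇒-covered st (M u)) rest)
      where
      rest : ∀ {h ρ} →
        cond (# 0) (ret (# 2)) (ret (cons nil (tl (# 1))))
          ⊢ bool (covered st (M u)) ∙ (h ∙ bits (M u)) ∙ chosen c ∙ ρ
          ⇒ chosen (if not (covered st (M u)) then just u else c)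
      rest with covered st (M u)
      ... | true  = ⇒-cond-∙ refl (⇒-ret refl)
      ... | false = ⇒-cond-nil refl (⇒-ret refl)

    ⇒-select : ∀ (st : Matrix k n) {l a ρ} →
               selectT ⊢ (matrix st ∙ l) ∙ a ∙ rows ∙ ρ ⇒ chosen (select M W st)
    ⇒-select st {l} {a} {ρ} = ⇒-fold n≤B refl refl (steps n (λ u → u) nothing)
      where
      steps : ∀ m (f : Fin m → Fin n) c →
        Fold selectStep ((matrix st ∙ l) ∙ a ∙ rows ∙ ρ) m
          (tab m λ i → bool (W (f i)) ∙ bits (M (f i))) (chosen c)
          (chosen (choose m (λ i → W (f i) ∧ not (covered st (M (f i)))) f c))
      steps zero    f c = []
      steps (suc m) f c = ⇒-selectStep st (f zero) c ∷ steps m (f ∘ suc) _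

    ⇒-child : ∀ (st : Matrix k n) row i {b c a z m l ρ} →
      childT ⊢ b ∙ (bits (identity k i) ∙ c) ∙ a ∙ z ∙ (m ∙ bits row) ∙ (matrix st ∙ l) ∙ ρ
             ⇒ matrix (child st row i)
    ⇒-child st row i = ⇒-bind (⇒-call₂ (⇒-zip k k≤B)) (⇒-map k k≤B refl λ j → entry j)
      where
      entry : ∀ j {a z b e a′ z′ m ρ} →
        cond (hd (# 0)) (call₂ andT (tl (# 0)) (tl (# 7))) (ret (tl (# 0)))
          ⊢ (bool (identity k i j) ∙ bits (st j)) ∙ a ∙ z ∙ b ∙ e ∙ a′ ∙ z′ ∙ (m ∙ bits row) ∙ ρ
          ⇒ bits (child st row i j)
      entry j with identity k i j
      ... | true  = ⇒-cond-∙ refl (⇒-call₂ (⇒-and n≤B (st j) row))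
      ... | false = ⇒-cond-nil refl (⇒-ret refl)

    ⇒-pushStep : ∀ (st : Matrix k n) row i sts {z m l ρ} →
      pushT ⊢ (bits (identity k i) ∙ bits (st i)) ∙ list matrix sts ∙ z ∙ (m ∙ bits row) ∙ (matrix st ∙ l) ∙ ρ
            ⇒ list matrix (if meets (st i) row then child st row i ∷ sts else sts)
    ⇒-pushStep st row i sts {z} {m} {l} {ρ} = ⇒-bind (⇒-call₂ (⇒-meets n≤B (st i) row)) rest
      where
      rest :
        cond (# 0) (bind childT (ret (cons (# 0) (# 3)))) (ret (# 2))
          ⊢ bool (meets (st i) row) ∙ (bits (identity k i) ∙ bits (st i)) ∙ list matrix sts ∙ z ∙ (m ∙ bits row) ∙ (matrix st ∙ l) ∙ ρ
          ⇒ list matrix (if meets (st i) row then child st row i ∷ sts else sts)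
      rest with meets (st i) row
      ... | true  = ⇒-cond-∙ refl (⇒-bind (⇒-child st row i) (⇒-ret refl))
      ... | false = ⇒-cond-nil refl (⇒-ret refl)

    state : List (Matrix k n) → Bool → 𝔻
    state sts b = list matrix sts ∙ bool b ∙ rows ∙ matrix (identity k) ∙ nil

    explored : Matrix k n → List (Matrix k n) → Maybe (Fin n) → 𝔻
    explored st sts nothing  = state [] true
    explored st sts (just u) = state (push st (M u) sts) false

    ⇒-push : ∀ (st : Matrix k n) row sts {m ρ} →
      fold (# 0) (tl (# 2)) pushT
        ⊢ (tab k λ i → bits (identity k i) ∙ bits (st i)) ∙ (m ∙ bits row) ∙ (matrix st ∙ list matrix sts) ∙ ρ
        ⇒ list matrix (push st row sts)
    ⇒-push st row sts {m} {ρ} = ⇒-fold k≤B refl refl (steps k (λ i → i) sts)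
      where
      steps : ∀ j (f : Fin j → Fin k) acc →
        Fold pushT ((tab k λ i → bits (identity k i) ∙ bits (st i)) ∙ (m ∙ bits row) ∙ (matrix st ∙ list matrix sts) ∙ ρ) j
          (tab j λ i → bits (identity k (f i)) ∙ bits (st (f i))) (list matrix acc)
          (list matrix (keepIf j (λ i → meets (st (f i)) row) (λ i → child st row (f i)) acc))
      steps zero    f acc = []
      steps (suc j) f acc = ⇒-pushStep st row (f zero) acc ∷ steps j (f ∘ suc) _

    ⇒-explore : ∀ st sts → exploreT ⊢ state (st ∷ sts) false ⇒ explored st sts (select M W st)
    ⇒-explore st sts = ⇒-bind (⇒-select st) rest
      where
      rest : cond (# 0)
               (bind (call₂ zipT (# 4) (hd (# 1)))
                 (bind (fold (# 0) (tl (# 2)) pushT) (ret (cons (# 0) (tails 4)))))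
               (ret (cons nil (cons yes′ (tails 3))))
               ⊢ chosen (select M W st) ∙ state (st ∷ sts) false ⇒ explored st sts (select M W st)
      rest with select M W st
      ... | nothing = ⇒-cond-nil refl (⇒-ret refl)
      ... | just u  = ⇒-cond-∙ refl
        (⇒-bind (⇒-call₂ (⇒-zip k k≤B)) (⇒-bind (⇒-push st (M u) sts) (⇒-ret refl)))

-- The search tree

∧-intro : ∀ {a b} → a ≡ true → b ≡ true → a ∧ b ≡ true
∧-intro refl refl = refl

∧-elim : ∀ a {b} → a ∧ b ≡ true → a ≡ true × b ≡ true
∧-elim true eq = refl , eq

∧-not-elim : ∀ a {b} → a ∧ not b ≡ true → a ≡ true × b ≡ false
∧-not-elim true {false} eq = refl , refl

some-intro : ∀ {n} p (i : Fin n) → p i ≡ true → some n p ≡ true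
some-intro p zero    eq = cong (_∨ some _ (p ∘ suc)) eq
some-intro p (suc i) eq = trans (cong (p zero ∨_) (some-intro (p ∘ suc) i eq)) (∨-zeroʳ (p zero))

some-elim : ∀ n p → some n p ≡ true → ∃[ i ] p i ≡ true
some-elim (suc n) p eq with p zero in eq₀
... | true  = zero , eq₀
... | false with i , eqᵢ ← some-elim n (p ∘ suc) eq = suc i , eqᵢ

some-false : ∀ {n} p (i : Fin n) → some n p ≡ false → p i ≡ false
some-false p i eq with p i in eqᵢ
... | false = refl
... | true  = trans (sym (some-intro p i eqᵢ)) eq

identity-refl : ∀ {n} (i : Fin n) → identity n i i ≡ true
identity-refl zero    = refl
identity-refl (suc i) = identity-refl i

identity-elim : ∀ {n} (i j : Fin n) → identity n i j ≡ true → i ≡ j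
identity-elim zero    zero    eq = refl
identity-elim (suc i) (suc j) eq = cong suc (identity-elim i j eq)

choose-just : ∀ {A : Set} n p f (c : Maybe A) {x} → choose n p f c ≡ just x →
              c ≡ just x ⊎ (∃[ i ] p i ≡ true × f i ≡ x)
choose-just zero    p f c eq = inj₁ eq
choose-just (suc n) p f c eq with p zero in eq₀ | choose-just n (p ∘ suc) (f ∘ suc) _ eq
... | true  | inj₁ refl = inj₂ (zero , eq₀ , refl)
... | false | inj₁ eq′  = inj₁ eq′
... | _     | inj₂ (i , eqᵢ , eqf) = inj₂ (suc i , eqᵢ , eqf)

choose-nothing : ∀ {A : Set} n p f (c : Maybe A) → choose n p f c ≡ nothing →
                 c ≡ nothing × (∀ i → p i ≡ false)
choose-nothing zero    p f c eq = eq , λ ()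
choose-nothing (suc n) p f c eq with p zero in eq₀ | choose-nothing n (p ∘ suc) (f ∘ suc) _ eq
... | false | c≡ , none = c≡ , λ { zero → eq₀ ; (suc i) → none i }

module _ {A : Set} {P : A → Set} where

  keepIf-old : ∀ n p (f : Fin n → A) {xs} → Any P xs → Any P (keepIf n p f xs)
  keepIf-old zero    p f any = any
  keepIf-old (suc n) p f any with p zero
  ... | true  = keepIf-old n (p ∘ suc) (f ∘ suc) (there any)
  ... | false = keepIf-old n (p ∘ suc) (f ∘ suc) any

  keepIf-new : ∀ n p (f : Fin n → A) {xs} i → p i ≡ true → P (f i) → Any P (keepIf n p f xs)
  keepIf-new (suc n) p f zero    eq Pf rewrite eq = keepIf-old n (p ∘ suc) (f ∘ suc) (here Pf)
  keepIf-new (suc n) p f (suc i) eq Pf = keepIf-new n (p ∘ suc) (f ∘ suc) i eq Pf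

module _ {n : ℕ} (k : ℕ) (M : Matrix n n) where

  Hits : (Fin k → Fin n) → Fin n → Set
  Hits x u = ∃[ j ] M u (x j) ≡ true

  -- The latest branching vertex stands at the head, so ladders grow by `_∷_` as the search
  -- descends.
  infixr 5 _∷_
  data Ladder : List (Fin n) → Set where
    []  : Ladder []
    _∷_ : ∀ {w ws} → (∃[ x ] All (Hits x) ws × ¬ Hits x w) → Ladder ws → Ladder (w ∷ ws)

module Tree {n k : ℕ} (M : Matrix n n) (W : Fin n → Bool) (L : ℕ)
            (bounded : ∀ ws → Ladder k M ws → length ws ≤ L) where

  -- ws are the vertices branched on so far, and h bounds how many more there can be.
  record Node (h : ℕ) (st : Matrix k n) : Set where
    field
      ws        : List (Fin n)
      ladder    : Ladder k M ws
      assigned  : All (λ w → ∃[ j ] (∀ v → st j v ≡ true → M w v ≡ true)) ws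
      height    : length ws + h ≡ L
      inhabited : ∀ j → ∃[ v ] st j v ≡ true

  open Node

  Solution : (Fin k → Fin n) → Set
  Solution x = ∀ u → W u ≡ true → Hits k M x u

  Consistent : (Fin k → Fin n) → Matrix k n → Set
  Consistent x st = ∀ j → st j (x j) ≡ true

  -- Each candidate set contains a vertex outside the ball around `u`. These k vertices miss `u`,
  -- yet hit every earlier w, because one of the sets lies entirely in the ball around w.
  extend : ∀ {h st u} (N : Node h st) → covered st (M u) ≡ false → Ladder k M (u ∷ ws N)
  extend {st = st} {u} N uncovered =
    (x , All.map hit (assigned N) , miss) ∷ ladder N
    where
    escaping : ∀ j → ∃[ v ] st j v ≡ true × M u v ≡ false
    escaping j with escapes (st j) (M u) in eq | some-false (λ j → not (escapes (st j) (M u))) j uncovered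
    ... | true | _ with v , eqᵥ ← some-elim n _ eq = v , ∧-not-elim (st j v) eqᵥ
    x : Fin k → Fin n
    x j = proj₁ (escaping j)
    hit : ∀ {w} → ∃[ j ] (∀ v → st j v ≡ true → M w v ≡ true) → Hits k M x w
    hit (j , sub) = j , sub (x j) (proj₁ (proj₂ (escaping j)))
    miss : ¬ Hits k M x u
    miss (j , eq) with () ← trans (sym eq) (proj₂ (proj₂ (escaping j)))

  -- At height 0 the ladder already has length `L`, and `u` would make it too long.
  ¬uncovered : ∀ {st u} → Node 0 st → covered st (M u) ≡ false → ⊥
  ¬uncovered N uncovered = <-irrefl (trans (sym (+-identityʳ _)) (height N)) (bounded _ (extend N uncovered))

  child-⊆ : ∀ (st : Matrix k n) row i j v → child st row i j v ≡ true → st j v ≡ true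
  child-⊆ st row i j v eq with identity k i j
  ... | true  = proj₁ (∧-elim (st j v) eq)
  ... | false = eq

  child-self : ∀ (st : Matrix k n) row i v → child st row i i v ≡ true → row v ≡ true
  child-self st row i v eq rewrite identity-refl i = proj₂ (∧-elim (st i v) eq)

  child-intro : ∀ (st : Matrix k n) row i j v → st j v ≡ true → (i ≡ j → row v ≡ true) →
                child st row i j v ≡ true
  child-intro st row i j v eq eq′ with identity k i j in eqᵢ
  ... | true  = ∧-intro eq (eq′ (identity-elim i j eqᵢ))
  ... | false = eq

  child-node : ∀ {h st u} i → Node (suc h) st → covered st (M u) ≡ false →
               meets (st i) (M u) ≡ true → Node h (child st (M u) i)
  child-node {st = st} {u} i N uncovered meet = record
    { ws        = u ∷ ws N
    ; ladder    = extend N uncovered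
    ; assigned  = (i , child-self st (M u) i) ∷
                  All.map (λ (j , sub) → j , λ v → sub v ∘ child-⊆ st (M u) i j v) (assigned N)
    ; height    = trans (sym (+-suc _ _)) (height N)
    ; inhabited = inh
    }
    where
    inh : ∀ j → ∃[ v ] child st (M u) i j v ≡ true
    inh j with identity k i j in eq
    ... | false = inhabited N j
    ... | true with refl ← identity-elim i j eq = some-elim n _ meet

  -- A node below which h levels remain accounts for at most (1 + k) ^ h iterations.
  data Nodes : List (Matrix k n) → ℕ → Set where
    []  : Nodes [] 0
    _∷_ : ∀ {h st sts m} → Node h st → Nodes sts m → Nodes (st ∷ sts) (suc k ^ h + m)

  keepIf-nodes : ∀ {h m} j p f {sts} → (∀ i → p i ≡ true → Node h (f i)) → Nodes sts m →
                 ∃[ m′ ] Nodes (keepIf j p f sts) m′ × m′ ≤ j * suc k ^ h + m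
  keepIf-nodes         zero    p f nodes Ns = _ , Ns , ≤-refl
  keepIf-nodes {h} {m} (suc j) p f nodes Ns with p zero in eq
  ... | false with m′ , Ns′ , m′≤ ← keepIf-nodes j (p ∘ suc) (f ∘ suc) (nodes ∘ suc) Ns =
    m′ , Ns′ , ≤-trans m′≤ (+-monoˡ-≤ m (m≤n+m (j * suc k ^ h) (suc k ^ h)))
  ... | true  with m′ , Ns′ , m′≤ ← keepIf-nodes j (p ∘ suc) (f ∘ suc) (nodes ∘ suc) (nodes zero eq ∷ Ns) =
    m′ , Ns′ , ≤-trans m′≤ (≤-reflexive (trans (sym (+-assoc (j * K) K m)) (cong (_+ m) (+-comm (j * K) K))))
    where K = suc k ^ h

  -- Some `x j` dominates `u`, so it survives the intersection of set `j` with the ball around `u`,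
  -- and `x` remains consistent with child `j`.
  push-consistent : ∀ {x st u sts} → Solution x → W u ≡ true → Any (Consistent x) (st ∷ sts) →
                    Any (Consistent x) (push st (M u) sts)
  push-consistent {x} {st} {u} sol Wu (here x∈st) with j , eq ← sol u Wu =
    keepIf-new k _ (child st (M u)) j (some-intro _ (x j) (∧-intro (x∈st j) eq))
      (λ j′ → child-intro st (M u) j j′ (x j′) (x∈st j′) λ { refl → eq })
  push-consistent {st = st} {u} sol Wu (there any) = keepIf-old k _ (child st (M u)) any

  nothing-uncovered : ∀ {h st} → Node h st → select M W st ≡ nothing → ∃[ x ] Solution x
  nothing-uncovered {st = st} N eq = x , sol
    where
    x : Fin k → Fin n
    x j = proj₁ (inhabited N j)
    sol : Solution x
    -- As `select` found nothing, `W u ∧ not (covered st (M u))` is false. Together with `Wu` this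
    -- gives the second scrutinee, which rules out the uncovered case.
    sol u Wu with covered st (M u) in cov
                | trans (cong (_∧ not (covered st (M u))) (sym Wu))
                    (proj₂ (choose-nothing n (λ u → W u ∧ not (covered st (M u))) (λ u → u) nothing eq) u)
    ... | true | _ with j , eqⱼ ← some-elim k _ cov with M u (x j) in eqₘ
    ...   | true  = j , eqₘ
    ...   | false = contradiction (trans (sym eqⱼ) (cong not
            (some-intro (λ v → st j v ∧ not (M u v)) (x j)
              (∧-intro (proj₂ (inhabited N j)) (cong not eqₘ))))) λ ()

  selected-uncovered : ∀ {st : Matrix k n} {u} → select M W st ≡ just u →
                       W u ≡ true × covered st (M u) ≡ false
  selected-uncovered {st} eq
    with choose-just n (λ u → W u ∧ not (covered st (M u))) (λ u → u) nothing eq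
  ... | inj₂ (u , eqᵤ , refl) = ∧-not-elim (W u) eqᵤ

-- The main loop: termination, soundness and completeness

module _ {B : ℕ} (2≤B : 2 ≤ B) {n k : ℕ} (n≤B : n ≤ B) (k≤B : k ≤ B)
         (M : Matrix n n) (W : Fin n → Bool) {L : ℕ}
         (bounded : ∀ ws → Ladder k M ws → length ws ≤ L) where

  open Timed 2≤B
  open Programs 2≤B
  open Explore n≤B k≤B M W
  open Tree M W L bounded

  -- A negative answer excludes only solutions consistent with a node on the stack. At the root,
  -- where all sets are full, these are all solutions.
  record Outcome (sts : List (Matrix k n)) (m : ℕ) : Set where
    field
      {iterations} : ℕ
      {answer}     : Bool
      iterations≤  : iterations ≤ m
      execution    : While exploreT iterations (state sts false) (state [] answer)
      sound        : answer ≡ true → ∃[ x ] Solution x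
      complete     : answer ≡ false → ∀ x → Solution x → ¬ Any (Consistent x) sts

  -- A node gives way to its children, so recursion on the stack is not structural; it runs on a
  -- bound for the total weight `m` instead. `explore-node` takes the result of `select` as an
  -- argument in order to match on it.
  explore-while : ∀ fuel sts {m} → Nodes sts m → m ≤ fuel → Outcome sts m
  explore-node  : ∀ fuel {h st} sts {m} → Node h st → Nodes sts m → suc k ^ h + m ≤ suc fuel →
                  ∀ s → select M W st ≡ s → exploreT ⊢ state (st ∷ sts) false ⇒ explored st sts s →
                  Outcome (st ∷ sts) (suc k ^ h + m)

  explore-while fuel [] [] m≤ = record
    { iterations≤ = z≤n
    ; execution   = exit
    ; sound       = λ ()
    ; complete    = λ _ _ _ ()
    }
  explore-while zero (st ∷ sts) (_∷_ {h} N Ns) m≤ =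
    -- Every node has positive weight, so fuel cannot run out on a non-empty stack.
    contradiction (≤-trans (≤-trans (m^n>0 (suc k) h) (m≤m+n _ _)) m≤) λ ()
  explore-while (suc fuel) (st ∷ sts) (N ∷ Ns) m≤ =
    explore-node fuel sts N Ns m≤ (select M W st) refl (⇒-explore st sts)

  explore-node fuel {h} sts {m} N Ns m≤ nothing eq p = record
    { iterations≤ = ≤-trans (m^n>0 (suc k) h) (m≤m+n _ m)
    ; execution   = again p exit
    ; sound       = λ _ → nothing-uncovered N eq
    ; complete    = λ ()
    }
  explore-node fuel {zero} sts N Ns m≤ (just u) eq p =
    ⊥-elim (¬uncovered N (proj₂ (selected-uncovered eq)))
  explore-node fuel {suc h} {st} sts {m} N Ns m≤ (just u) eq p
    with Wu , uncovered ← selected-uncovered eq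
    with m′ , Ns′ , m′≤ ← keepIf-nodes k (λ i → meets (st i) (M u)) (child st (M u))
                            (λ i → child-node i N uncovered) Ns
    = record
    { iterations≤ = ≤-trans (s≤s (Outcome.iterations≤ rest)) decrease
    ; execution   = again p (Outcome.execution rest)
    ; sound       = Outcome.sound rest
    ; complete    = λ ans x sol → Outcome.complete rest ans x sol ∘ push-consistent sol Wu
    }
    where
    -- The parent weighs (1 + k) · (1 + k) ^ h and its children at most k · (1 + k) ^ h together;
    -- the difference pays for the present iteration.
    decrease : suc m′ ≤ suc k ^ suc h + m
    decrease = ≤-trans (+-mono-≤ (m^n>0 (suc k) h) m′≤) (≤-reflexive (sym (+-assoc (suc k ^ h) _ m)))
    rest : Outcome (push st (M u) sts) m′
    rest = explore-while fuel (push st (M u) sts) Ns′ (s≤s⁻¹ (≤-trans decrease m≤))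

-- The whole search, including the test k ≤ n

num≡tab : ∀ m → num m ≡ tab m λ _ → nil
num≡tab zero    = refl
num≡tab (suc m) = cong (nil ∙_) (num≡tab m)

drop : ℕ → 𝔻 → 𝔻
drop zero    l = l
drop (suc k) l = drop k (right l)

drop-all : ∀ k l → len l ≤ k → drop k l ≡ nil
drop-all zero    nil     _         = refl
drop-all (suc k) nil     _         = drop-all k nil z≤n
drop-all (suc k) (h ∙ l) (s≤s len≤) = drop-all k l len≤

drop-some : ∀ k l → k < len l → ∃[ h ] ∃[ l′ ] drop k l ≡ h ∙ l′
drop-some zero    (h ∙ l) _        = h , l , refl
drop-some (suc k) (h ∙ l) (s≤s k<) = drop-some k l k<

module _ {B : ℕ} (2≤B : 2 ≤ B) {n k d : ℕ} (n≤B : n ≤ B) (k≤B : k ≤ B) (d≤B : d ≤ B)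
         (A : Matrix n n) (W : Fin n → Bool) {L : ℕ} (K^L≤B : suc k ^ L ≤ B)
         (bounded : ∀ ws → Ladder k (balls A d) ws → length ws ≤ L) where

  open Timed 2≤B
  open Programs 2≤B

  private
    M : Matrix n n
    M = balls A d

  open Explore n≤B k≤B M W
  open Tree M W L bounded

  private
    full : Matrix k n
    full _ _ = true

    root : k ≤ n → Node L full
    root k≤n = record
      { ws        = []
      ; ladder    = []
      ; assigned  = []
      ; height    = refl
      -- An index `j` exists only if k ≥ 1, and then `k≤n` provides a vertex.
      ; inhabited = λ j → inject≤ j k≤n , refl
      }

    drop-fold : ∀ {ρ} k l → Fold (ret (tl (# 1))) ρ k (num k) l (drop k l)
    drop-fold zero    l = []
    drop-fold (suc k) l = ⇒-ret refl ∷ drop-fold k (right l)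

    len-rest : len (nil ∙ matrix A) ≡ suc n
    len-rest = cong suc (len-tab n _)

    decide : Tm
    decide = cond (# 0)
      (seq (ret (cons (cons (# 1) nil) (cons nil (cons (# 4) (cons (# 3) nil)))))
      (seq (loop exploreT) (ret (# 1))))
      (ret nil)

    prepare : ∀ {v} →
      (∀ {o ρ} → decide ⊢ drop k (nil ∙ matrix A) ∙ matrix full ∙ o ∙ matrix (identity k) ∙ rows ∙ ρ ⇒ v) →
      searchT ⊢ matrix A ∙ bits W ∙ num k ∙ num d ⇒ v
    prepare p =
      ⇒-seq (⇒-ret refl)
      (⇒-bind (⇒-call₂ (⇒-balls n≤B A d d≤B))
      (⇒-bind (⇒-call₂ (⇒-zip n n≤B))
      (⇒-bind (⇒-call₁ (subst (λ l → identityT ⊢ l ∙ nil ⇒ matrix (identity k)) (sym (num≡tab k))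
                              (⇒-identity k k≤B)))
      (⇒-bind (⇒-map n n≤B refl λ _ → ⇒-ret refl)
      (⇒-bind (⇒-map k k≤B (num≡tab k) λ _ → ⇒-ret refl)
      (⇒-bind (⇒-fold k≤B refl refl (drop-fold k _))
      p))))))

  search-correct : ∃[ b ] searchT ⊢ matrix A ∙ bits W ∙ num k ∙ num d ⇒ bool b ×
                          Reflects (k ≤ n × ∃[ x ] Solution x) b
  search-correct with k ≤? n
  ... | no k≰n = false ,
    prepare (⇒-cond-nil (drop-all k (nil ∙ matrix A) (≤-trans (≤-reflexive len-rest) (≰⇒> k≰n))) (⇒-ret refl)) ,
    ofⁿ (k≰n ∘ proj₁)
  ... | yes k≤n
    with o ← explore-while 2≤B n≤B k≤B M W bounded _ (full ∷ []) (root k≤n ∷ []) ≤-refl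
    = Outcome.answer o ,
      prepare (⇒-cond-∙ (proj₂ (proj₂ (drop-some k (nil ∙ matrix A) (≤-trans (s≤s k≤n) (≤-reflexive (sym len-rest))))))
        (⇒-seq (⇒-ret refl) (⇒-seq (⇒-loop it≤B (Outcome.execution o)) (⇒-ret refl)))) ,
      reflects (Outcome.answer o) refl
    where
    it≤B : Outcome.iterations o ≤ B
    it≤B = ≤-trans (Outcome.iterations≤ o) (≤-trans (≤-reflexive (+-identityʳ _)) K^L≤B)
    reflects : ∀ b → Outcome.answer o ≡ b → Reflects (k ≤ n × ∃[ x ] Solution x) b
    reflects true  eq = ofʸ (k≤n , Outcome.sound o eq)
    reflects false eq = ofⁿ λ (_ , x , sol) → Outcome.complete o eq x sol (here λ _ → refl)

-- Subsets

insert : ∀ {n} → Fin n → Subset n → Subset n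
insert v p = p [ v ]≔ true

insert-self : ∀ {n} v (p : Subset n) → v ∈ insert v p
insert-self zero    (_ ∷ p) = here
insert-self (suc v) (_ ∷ p) = there (insert-self v p)

insert-old : ∀ {n u} v (p : Subset n) → u ∈ p → u ∈ insert v p
insert-old zero    (_ ∷ p) here        = here
insert-old zero    (_ ∷ p) (there u∈p) = there u∈p
insert-old (suc v) (_ ∷ p) here        = here
insert-old (suc v) (_ ∷ p) (there u∈p) = there (insert-old v p u∈p)

insert-elim : ∀ {n u} v (p : Subset n) → u ∈ insert v p → u ≡ v ⊎ u ∈ p
insert-elim zero    (_ ∷ p) here        = inj₁ refl
insert-elim zero    (_ ∷ p) (there u∈p) = inj₂ (there u∈p)
insert-elim (suc v) (_ ∷ p) here        = inj₂ here
insert-elim (suc v) (_ ∷ p) (there u∈)  with insert-elim v p u∈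
... | inj₁ refl = inj₁ refl
... | inj₂ u∈p  = inj₂ (there u∈p)

∣insert∣ : ∀ {n} v (p : Subset n) → v ∉ p → ∣ insert v p ∣ ≡ suc ∣ p ∣
∣insert∣ zero    (true  ∷ p) v∉p = contradiction here v∉p
∣insert∣ zero    (false ∷ p) v∉p = refl
∣insert∣ (suc v) (true  ∷ p) v∉p = cong suc (∣insert∣ v p (v∉p ∘ there))
∣insert∣ (suc v) (false ∷ p) v∉p = ∣insert∣ v p (v∉p ∘ there)

∣insert∣≤ : ∀ {n} v (p : Subset n) → ∣ insert v p ∣ ≤ suc ∣ p ∣
∣insert∣≤ zero    (true  ∷ p) = n≤1+n _
∣insert∣≤ zero    (false ∷ p) = ≤-refl
∣insert∣≤ (suc v) (true  ∷ p) = s≤s (∣insert∣≤ v p)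
∣insert∣≤ (suc v) (false ∷ p) = ∣insert∣≤ v p

missing : ∀ {n} (p : Subset n) → ∣ p ∣ < n → ∃[ v ] v ∉ p
missing (false ∷ p) _        = zero , λ ()
missing (true  ∷ p) (s≤s p<) with v , v∉p ← missing p p< = suc v , λ { (there v∈p) → v∉p v∈p }

-- The search yields a family with possible repetitions. Each repeated entry is made up for by an
-- arbitrary new vertex, which exists because k ≤ n.
cover : ∀ {n} k (x : Fin k → Fin n) → k ≤ n → ∃[ X ] ∣ X ∣ ≡ k × (∀ j → x j ∈ X)
cover {n} zero    x _   = ⊥ˢ , ∣⊥∣≡0 n , λ ()
cover {n} (suc k) x k<n with X , ∣X∣ , x∈X ← cover k (x ∘ suc) (<⇒≤ k<n) | x zero ∈? X
... | no  x₀∉X = insert (x zero) X , trans (∣insert∣ _ X x₀∉X) (cong suc ∣X∣) ,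
                 λ { zero → insert-self _ X ; (suc j) → insert-old _ X (x∈X j) }
... | yes x₀∈X with v , v∉X ← missing X (subst (_< n) (sym ∣X∣) k<n) =
  insert v X , trans (∣insert∣ v X v∉X) (cong suc ∣X∣) ,
  λ { zero → insert-old v X x₀∈X ; (suc j) → insert-old v X (x∈X j) }

enumerate : ∀ {n} (p : Subset n) → Fin ∣ p ∣ → Fin n
enumerate (true  ∷ p) zero    = zero
enumerate (true  ∷ p) (suc i) = suc (enumerate p i)
enumerate (false ∷ p) i       = suc (enumerate p i)

enumerate-surjective : ∀ {n v} (p : Subset n) → v ∈ p → ∃[ i ] enumerate p i ≡ v
enumerate-surjective (true  ∷ p) here        = zero , refl
enumerate-surjective (true  ∷ p) (there v∈p) with i , refl ← enumerate-surjective p v∈p = suc i , refl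
enumerate-surjective (false ∷ p) (there v∈p) with i , refl ← enumerate-surjective p v∈p = i , refl

fromList : ∀ {n} → List (Fin n) → Subset n
fromList []       = ⊥ˢ
fromList (v ∷ vs) = insert v (fromList vs)

∈-fromList : ∀ {n v} {vs : List (Fin n)} → v ∈ᴸ vs → v ∈ fromList vs
∈-fromList {vs = v ∷ vs} (here refl) = insert-self v (fromList vs)
∈-fromList {vs = v ∷ vs} (there v∈)  = insert-old v (fromList vs) (∈-fromList v∈)

fromList-∈ : ∀ {n v} (vs : List (Fin n)) → v ∈ fromList vs → v ∈ᴸ vs
fromList-∈ []       v∈ = contradiction v∈ ∉⊥
fromList-∈ (v ∷ vs) v∈ with insert-elim v (fromList vs) v∈
... | inj₁ refl = here refl
... | inj₂ v∈′  = there (fromList-∈ vs v∈′)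

∣fromList∣≤ : ∀ {n} (vs : List (Fin n)) → ∣ fromList vs ∣ ≤ length vs
∣fromList∣≤ {n} []  = ≤-reflexive (∣⊥∣≡0 n)
∣fromList∣≤ (v ∷ vs) = ≤-trans (∣insert∣≤ v (fromList vs)) (s≤s (∣fromList∣≤ vs))

-- Pigeonhole

module _ {A : Set} (p : A → Bool) where

  length-partition : ∀ xs → length (filter (λ x → p x ≟ᵇ true) xs) +
                            length (filter (λ x → p x ≟ᵇ false) xs) ≡ length xs
  length-partition []       = refl
  length-partition (x ∷ xs) with p x
  ... | true  = cong suc (length-partition xs)
  ... | false = trans (+-suc _ _) (cong suc (length-partition xs))

  majority : ∀ q xs → 2 * q < length xs → ∃[ b ] q < length (filter (λ x → p x ≟ᵇ b) xs)
  majority q xs 2q< with q <? length (filter (λ x → p x ≟ᵇ true) xs)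
  ... | yes q< = true , q<
  ... | no  q≮ with q <? length (filter (λ x → p x ≟ᵇ false) xs)
  ...   | yes q< = false , q<
  ...   | no q≮′ = contradiction 2q< (≤⇒≯ (begin
    length xs      ≡⟨ length-partition xs ⟨
    _              ≤⟨ +-mono-≤ (≮⇒≥ q≮) (≮⇒≥ q≮′) ⟩
    q + q          ≡⟨ cong (q +_) (+-identityʳ q) ⟨
    2 * q          ∎))
    where open ≤-Reasoning

-- Passing to the majority value of each of the `c` bits in turn at worst halves the list `c` times.
homogeneous : ∀ {A : Set} c (φ : Fin c → A → Bool) q xs → 2 ^ c * q < length xs →
  ∃[ ys ] ys ⊆ᴸ xs × q < length ys × (∀ i {x y} → x ∈ᴸ ys → y ∈ᴸ ys → φ i x ≡ φ i y)
homogeneous zero    φ q xs q< = xs , ⊆-refl , subst (_< length xs) (+-identityʳ q) q< , λ ()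
homogeneous (suc c) φ q xs q<
  with b , q<′ ← majority (φ zero) (2 ^ c * q) xs (subst (_< length xs) (*-assoc 2 (2 ^ c) q) q<)
  with ys , ys⊆ , q<″ , same ← homogeneous c (φ ∘ suc) q _ q<′
  = ys , ⊆-trans ys⊆ (filter-⊆ (λ x → φ zero x ≟ᵇ b) xs) , q<″ ,
    λ { zero x∈ y∈ → trans (value x∈) (sym (value y∈)) ; (suc i) → same i }
  where
  value : ∀ {x} → x ∈ᴸ ys → φ zero x ≡ b
  value x∈ = All.lookup (All-resp-⊆ ys⊆ (all-filter (λ x → φ zero x ≟ᵇ b) xs)) x∈

-- Distances

module _ {G : Graph} where
  open Graph G using (order; _~_; _~?_; ~-sym)

  -- Without the minimality demanded by `N`, walks can be concatenated freely. Note that `N` takes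
  -- the centre first, here it comes second.
  Near : Subgraph G → ℕ → Fin order → Fin order → Set
  Near F d u v = ∃[ l ] l ≤ d × Walk F u v l

  module _ (F : Subgraph G) where
    open Subgraph F

    walk? : ∀ l u v → Dec (Walk F u v l)
    walk? zero    u v = map′ (λ { (refl , u∈) → stop u∈ }) (λ { (stop u∈) → refl , u∈ })
                          ((u ≟ᶠ v) ×-dec (u ∈? verts))
    walk? (suc l) u v = map′ (λ (_ , e , p) → step e p) (λ { (step e p) → _ , e , p })
                          (any? λ x → (u —? x) ×-dec walk? l x v)

    snoc : ∀ {u v w l} → Walk F u v l → v — w → Walk F u w (suc l)
    snoc (stop _)   e = step e (stop (—⇒∈ (—-sym e)))
    snoc (step f p) e = step f (snoc p e)

    reverse : ∀ {u v l} → Walk F u v l → Walk F v u l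
    reverse (stop u∈)  = stop u∈
    reverse (step e p) = snoc (reverse p) (—-sym e)

    _++_ : ∀ {u v w l m} → Walk F u v l → Walk F v w m → Walk F u w (l + m)
    stop _   ++ q = q
    step e p ++ q = step e (p ++ q)

    -- Lengths are tried in increasing order, which is possible as `walk?` decides each of them.
    shortest : ∀ {u v l} → Walk F u v l → ∃[ m ] m ≤ l × IsDist F u v m
    shortest {u} {v} {l} p = from 0 l refl λ ()
      where
      from : ∀ i j → i + j ≡ l → (∀ {m} → m < i → ¬ Walk F u v m) →
             ∃[ m ] m ≤ l × IsDist F u v m
      from i j i+j≡l none with walk? i u v
      ... | yes q = i , ≤-trans (m≤m+n i j) (≤-reflexive i+j≡l) , q ,
                    λ {m} r → ≮⇒≥ λ m<i → none m<i r
      from i zero    i+0≡l none | no ¬q =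
        contradiction (subst (Walk F u v) (trans (sym i+0≡l) (+-identityʳ i)) p) ¬q
      from i (suc j) i+j≡l none | no ¬q =
        from (suc i) j (trans (sym (+-suc i j)) i+j≡l) none′
        where
        none′ : ∀ {m} → m < suc i → ¬ Walk F u v m
        none′ m<1+i with m<1+n⇒m<n∨m≡n m<1+i
        ... | inj₁ m<i  = none m<i
        ... | inj₂ refl = ¬q

    near⇒N : ∀ {d u v} → Near F d u v → N F d v u
    near⇒N (l , l≤d , p) with m , m≤l , dist ← shortest p = m , dist , ≤-trans m≤l l≤d

    N⇒near : ∀ {d u v} → N F d v u → Near F d u v
    N⇒near (l , (p , _) , l≤d) = l , l≤d , p

  adjacent : Matrix order order
  adjacent u v = does (u ~? v)

  does-true : ∀ {P : Set} (P? : Dec P) → does P? ≡ true → P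
  does-true (yes p) _ = p

  balls-sound : ∀ d u w → balls adjacent d u w ≡ true → Near (whole G) d u w
  balls-sound zero    u w eq with refl ← identity-elim u w eq = 0 , z≤n , stop ∈⊤
  balls-sound (suc d) u w eq with balls adjacent d u w in eq′
  ... | true  with l , l≤d , p ← balls-sound d u w eq′ = l , m≤n⇒m≤1+n l≤d , p
  ... | false with v , eqᵥ ← some-elim order _ eq
              with a , b ← ∧-elim (adjacent u v) eqᵥ
              with l , l≤d , p ← balls-sound d w v b =
    suc l , s≤s l≤d , step (∈⊤ , ∈⊤ , does-true (u ~? v) a) (reverse (whole G) p)

  balls-complete : ∀ {d u w} → Near (whole G) d u w → balls adjacent d u w ≡ true
  balls-complete {zero}  {u} (zero , l≤ , stop _) = identity-refl u
  balls-complete {suc d} {u} {w} (zero , l≤ , stop u∈)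
    rewrite balls-complete {d} (zero , z≤n , stop u∈) = refl
  balls-complete {suc d} {u} {w} (suc l , s≤s l≤ , step {v = v} (_ , _ , u~v) p) =
    trans (cong (balls adjacent d u w ∨_)
      (some-intro (λ v → adjacent u v ∧ balls adjacent d w v) v
        (∧-intro (dec-true (u ~? v) u~v) (balls-complete (l , l≤ , reverse (whole G) p)))))
      (∨-zeroʳ _)

  -- The cut is made at the first vertex of the walk in `S`; the lengths of the pieces add up
  -- exactly, so no distance is lost.
  split : ∀ S {u v l} → Walk (whole G) u v l →
    Walk (G − S) u v l ⊎
    (∃[ s ] ∃[ a ] ∃[ b ] s ∈ S × Walk (whole G) u s a × Walk (whole G) s v b × a + b ≡ l)
  split S {u} {v} {l} p with u ∈? S
  ... | yes u∈S = inj₂ (u , 0 , l , u∈S , stop ∈⊤ , p , refl)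
  split S (stop _) | no u∉S = inj₁ (stop (x∉p⇒x∈∁p u∉S))
  split S (step e@(_ , _ , u~v) p) | no u∉S with split S p
  ... | inj₂ (s , a , b , s∈S , q , r , eq) = inj₂ (s , suc a , b , s∈S , step e q , r , cong suc eq)
  ... | inj₁ q = inj₁ (step (x∉p⇒x∈∁p u∉S , start q , u~v) q)
    where
    start : ∀ {v w l} → Walk (G − S) v w l → v ∈ ∁ S
    start (stop v∈)   = v∈
    start (step (v∈ , _) _) = v∈

-- Ladders in uniformly quasi-wide classes

module _ {k n : ℕ} {M : Matrix n n} where

  -- The same witnesses `x` serve, as they have fewer vertices to hit.
  ladder-⊆ : ∀ {ws vs} → vs ⊆ᴸ ws → Ladder k M ws → Ladder k M vs
  ladder-⊆ []          []                  = []
  ladder-⊆ (_ ∷ʳ vs⊆)  (_ ∷ l)             = ladder-⊆ vs⊆ l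
  ladder-⊆ (refl ∷ vs⊆) ((x , hit , miss) ∷ l) = (x , All-resp-⊆ vs⊆ hit , miss) ∷ ladder-⊆ vs⊆ l

  -- The witnesses `x` hit all of `ws` but miss `w`.
  ladder-∉ : ∀ {w ws} → Ladder k M (w ∷ ws) → ¬ (w ∈ᴸ ws)
  ladder-∉ ((x , hit , miss) ∷ _) w∈ = miss (All.lookup hit w∈)

  length≤∣fromList∣ : ∀ {ws} → Ladder k M ws → length ws ≤ ∣ fromList ws ∣
  length≤∣fromList∣ []                     = z≤n
  length≤∣fromList∣ {w ∷ ws} l@(_ ∷ l′) =
    ≤-trans (s≤s (length≤∣fromList∣ l′))
      (≤-reflexive (sym (∣insert∣ w _ (ladder-∉ l ∘ fromList-∈ ws))))

  ladder-lookup-≢ : ∀ {ws} → Ladder k M ws → ∀ i j → toℕ i < toℕ j → lookupᴸ ws i ≢ lookupᴸ ws j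
  ladder-lookup-≢ {w ∷ ws} l       zero    (suc j) _         eq =
    ladder-∉ l (subst (_∈ᴸ ws) (sym eq) (∈-lookup j))
  ladder-lookup-≢ {w ∷ ws} (_ ∷ l) (suc i) (suc j) (s≤s i<j) eq = ladder-lookup-≢ l i j i<j eq

-- With fewer than `s d` vertices in S there are at most 2 ^ (s d · (1 + d)) profiles of distances
-- to S. More than 1 + p vertices per profile on average leave some profile with p + 2 ≥ k + 2
-- vertices.
scatterSize : (ℕ → ℕ) → ℕ → ℕ → ℕ
scatterSize s p d = suc (2 ^ (s d * suc d) * suc p)

module _ {G : Graph} {s : ℕ → ℕ} {k p d : ℕ} (k≤p : k ≤ p) where
  open Graph G using (order)

  private
    M : Matrix order order
    M = balls (adjacent {G}) d

    -- Distances to `S` are coded in unary, by the truth values of distance at most j for all j ≤ d,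
    -- so that `homogeneous` applies.
    distanceBit : ∀ S → Fin ∣ S ∣ × Fin (suc d) → Fin order → Bool
    distanceBit S (a , j) w = balls (adjacent {G}) (toℕ j) w (enumerate S a)

    profile : ∀ S → Fin (∣ S ∣ * suc d) → Fin order → Bool
    profile S i = distanceBit S (remQuot (suc d) i)

    profile-combine : ∀ S a {e} (e<1+d : e < suc d) w →
      profile S (combine a (fromℕ< e<1+d)) w ≡ balls (adjacent {G}) e w (enumerate S a)
    profile-combine S a e<1+d w =
      trans (cong (λ aj → distanceBit S aj w) (remQuot-combine a (fromℕ< e<1+d)))
            (cong (λ j → balls (adjacent {G}) j w (enumerate S a)) (toℕ-fromℕ< e<1+d))

  -- A path from u to v through a ∈ S yields one from w to v, as w is at the same
  -- distances from S.
  avoids : ∀ S {u w v} → (∀ i → profile S i u ≡ profile S i w) → M u v ≡ true →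
           ¬ M w v ≡ true → N (G − S) d u v
  avoids S {u} {w} {v} same eq miss with balls-sound d u v eq
  ... | e , e≤d , walk with split S walk
  ...   | inj₁ walk′ = near⇒N (G − S) (e , e≤d , reverse (G − S) walk′)
  ...   | inj₂ (a , e₁ , e₂ , a∈S , walk₁ , walk₂ , e₁+e₂≡e)
    with c , refl ← enumerate-surjective S a∈S = contradiction near-v miss
    where
    e₁+e₂≤d : e₁ + e₂ ≤ d
    e₁+e₂≤d = ≤-trans (≤-reflexive e₁+e₂≡e) e≤d
    e₁<1+d : e₁ < suc d
    e₁<1+d = s≤s (≤-trans (m≤m+n e₁ e₂) e₁+e₂≤d)
    -- As e₁ ≤ d, the threshold e₁ is one of the profile bits, on which u and w agree.
    near-a : balls (adjacent {G}) e₁ w (enumerate S c) ≡ true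
    near-a = trans (sym (profile-combine S c e₁<1+d w))
      (trans (sym (same (combine c (fromℕ< e₁<1+d))))
      (trans (profile-combine S c e₁<1+d u) (balls-complete (e₁ , ≤-refl , walk₁))))
    near-v : M w v ≡ true
    near-v with f , f≤e₁ , walk-w ← balls-sound e₁ w (enumerate S c) near-a =
      balls-complete (f + e₂ , ≤-trans (+-monoˡ-≤ e₂ f≤e₁) e₁+e₂≤d , _++_ (whole G) walk-w walk₂)

  -- The head w of a sufficiently long subladder ys of constant profile is missed by
  -- its k vertices, one of which hits two others.
  no-large-scattered-ladder : ∀ {ws S A} → Ladder k M ws → ∣ S ∣ < s d → A ⊆ fromList ws →
    scatterSize s p d ≤ ∣ A ∣ → ¬ Scattered (G − S) d A
  no-large-scattered-ladder {ws} {S} {A} ladder ∣S∣< A⊆ large (_ , scattered) =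
    from (homogeneous (∣ S ∣ * suc d) (profile S) (suc p) (filter (_∈? A) ws) (begin-strict
      2 ^ (∣ S ∣ * suc d) * suc p       ≤⟨ *-monoˡ-≤ (suc p) (^-monoʳ-≤ 2 (*-monoˡ-≤ (suc d) (<⇒≤ ∣S∣<))) ⟩
      2 ^ (s d * suc d) * suc p         <⟨ large ⟩
      ∣ A ∣                             ≤⟨ p⊆q⇒∣p∣≤∣q∣ A⊆filter ⟩
      ∣ fromList (filter (_∈? A) ws) ∣  ≤⟨ ∣fromList∣≤ (filter (_∈? A) ws) ⟩
      length (filter (_∈? A) ws)        ∎))
    where
    open ≤-Reasoning
    A⊆filter : A ⊆ fromList (filter (_∈? A) ws)
    A⊆filter a∈A = ∈-fromList (∈-filter⁺ (_∈? A) (fromList-∈ ws (A⊆ a∈A)) a∈A)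
    from : ¬ (∃[ ys ] ys ⊆ᴸ filter (_∈? A) ws × suc p < length ys ×
              (∀ i {u v} → u ∈ᴸ ys → v ∈ᴸ ys → profile S i u ≡ profile S i v))
    from (w ∷ zs , ys⊆ , s≤s p<∣zs∣ , same)
      with (x , hit , miss) ∷ ladder′ ← ladder-⊆ (⊆-trans ys⊆ (filter-⊆ (_∈? A) ws)) ladder
      with i , j , i<j , eq ← pigeonhole (≤-trans (s≤s k≤p) p<∣zs∣) (λ i → proj₁ (All.lookup hit (∈-lookup i)))
      -- The vertex shared by i and j lies in both d-balls of G - S.
      = scattered (∈A i) (∈A j) (ladder-lookup-≢ ladder′ i j i<j) _
          (avoid i (proj₂ (hit-at i)) ,
           avoid j (subst (λ h → M (lookupᴸ zs j) (x h) ≡ true) (sym eq) (proj₂ (hit-at j))))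
      where
      hit-at : ∀ i → Hits k M x (lookupᴸ zs i)
      hit-at i = All.lookup hit (∈-lookup i)
      ∈A : ∀ i → lookupᴸ zs i ∈ A
      ∈A i = All.lookup (All-resp-⊆ ys⊆ (all-filter (_∈? A) ws)) (there (∈-lookup i))
      avoid : ∀ i {h} → M (lookupᴸ zs i) (x h) ≡ true → N (G − S) d (lookupᴸ zs i) (x h)
      avoid i {h} eq = avoids S (λ c → same c (there (∈-lookup i)) (here refl)) eq λ eq′ → miss (h , eq′)

  -- The vertices of a ladder are distinct, so a ladder exceeding the bound is a set large enough
  -- for quasi-wideness.
  ladder-bounded : ∀ {ℓ} {𝒞 : Pred Graph ℓ} {N𝒞} → UniformlyQuasiWide 𝒞 s N𝒞 → 𝒞 G →
    ∀ ws → Ladder k M ws → length ws ≤ N𝒞 (d , scatterSize s p d)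
  ladder-bounded {N𝒞 = N𝒞} uqw G∈𝒞 ws ladder with length ws ≤? N𝒞 (d , scatterSize s p d)
  ... | yes len≤ = len≤
  ... | no  len≰ with S , ∣S∣< , A , A⊆ , large , scattered ←
        uqw d (scatterSize s p d) G G∈𝒞 (fromList ws) (≤-trans (≰⇒> len≰) (length≤∣fromList∣ ladder))
    = contradiction scattered (no-large-scattered-ladder ladder ∣S∣< A⊆ large)

-- Computability of the time bound

-- The counterpart of `_⊢_⇒_` without a time bound, since computability asks only for termination.
infix 4 _⊩_↦_
record _⊩_↦_ (t : Tm) (ρ v : 𝔻) : Set where
  constructor eventually
  field
    {time} : ℕ
    run    : Run t ρ v time

↦-ret : ∀ {e ρ v} → eval₁ e ρ ≡ v → ret e ⊩ ρ ↦ v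
↦-ret {e} refl = eventually (run-ret e)

↦-seq : ∀ {t u ρ v w} → t ⊩ ρ ↦ v → u ⊩ v ↦ w → seq t u ⊩ ρ ↦ w
↦-seq {t} {u} (eventually p) (eventually q) = eventually (run-seq {t} {u} p q)

↦-call₂ : ∀ {t e f ρ v} → t ⊩ eval₁ e ρ ∙ eval₁ f ρ ∙ nil ↦ v → call₂ t e f ⊩ ρ ↦ v
↦-call₂ = ↦-seq (↦-ret refl)

↦-bind : ∀ {t u ρ v w} → t ⊩ ρ ↦ v → u ⊩ v ∙ ρ ↦ w → bind t u ⊩ ρ ↦ w
↦-bind {t} {u} (eventually p) (eventually q) = eventually (run-bind {t} {u} p q)

run-num-fold : ∀ {t ρ} n (a : ℕ → 𝔻) → (∀ i → t ⊩ nil ∙ a i ∙ ρ ↦ a (suc i)) →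
               ∃[ τ ] RunFold t ρ (num n) (a 0) (a n) τ
run-num-fold {t} {ρ} zero    a body = 3 , run-fold-nil {t} {ρ}
run-num-fold {t} {ρ} (suc n) a body
  with eventually {x} p ← body 0 | τ , q ← run-num-fold n (a ∘ suc) (body ∘ suc) =
  _ , run-fold-∙ {t} {ρ} {nil} {num n} {a 0} {a 1} {a (suc n)} {x} {τ} p q

↦-fold : ∀ {e f t ρ} n (a : ℕ → 𝔻) → eval₁ e ρ ≡ num n → eval₁ f ρ ≡ a 0 →
         (∀ i → t ⊩ nil ∙ a i ∙ ρ ↦ a (suc i)) → fold e f t ⊩ ρ ↦ a n
↦-fold {e} {f} {t} {ρ} n a eq eq′ body with τ , p ← run-num-fold n a body =
  eventually (run-fold {e} {f} {t} {ρ} {a n} {τ}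
    (subst (λ l → RunFold t ρ l _ (a n) τ) (sym eq)
      (subst (λ b → RunFold t ρ _ b (a n) τ) (sym eq′) p)))

↦-prog : ∀ {P i o b} → P on i yields o within b → prog P ⊩ i ↦ o
↦-prog {P} {i} (_ ∷ _ , t , p , refl , _) with t′ , q ← run-simulate p =
  eventually λ s → seq (setX-to (cons 𝕩 (nils extraVars)) (cong (i ∙_) (eval-nils extraVars)))
                       (seq (q s) assign)
  where open Program P

addT mulT powT : Tm
addT = fold (# 0) (# 1) (ret (cons nil (# 1)))
mulT = fold (# 0) nil (call₂ addT (# 3) (# 1))
powT = fold (# 1) yes′ (call₂ mulT (# 2) (# 1))

↦-add : ∀ m n {ρ} → addT ⊩ num m ∙ num n ∙ ρ ↦ num (m + n)
↦-add m n = ↦-fold m (λ i → num (i + n)) refl refl λ i → ↦-ret refl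

↦-mul : ∀ m n {ρ} → mulT ⊩ num m ∙ num n ∙ ρ ↦ num (m * n)
↦-mul m n = ↦-fold m (λ i → num (i * n)) refl refl λ i → ↦-call₂ (↦-add n (i * n))

↦-pow : ∀ m n {ρ} → powT ⊩ num m ∙ num n ∙ ρ ↦ num (m ^ n)
↦-pow m n = ↦-fold n (λ i → num (m ^ i)) refl refl λ i → ↦-call₂ (↦-mul m (m ^ i))

numeral : ℕ → Exp 1
numeral zero    = nil
numeral (suc n) = cons nil (numeral n)

eval-numeral : ∀ n {ρ} → eval₁ (numeral n) ρ ≡ num n
eval-numeral zero    = refl
eval-numeral (suc n) = cong (nil ∙_) (eval-numeral n)

total : (ℕ → ℕ) → ℕ → ℕ
total f zero    = 0
total f (suc n) = f n + total f n

summand≤total : ∀ f {i n} → i < n → f i ≤ total f n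
summand≤total f {i} {suc n} i<1+n with m<1+n⇒m<n∨m≡n i<1+n
... | inj₁ i<n  = ≤-trans (summand≤total f i<n) (m≤n+m _ (f n))
... | inj₂ refl = m≤m+n (f n) _

-- The time bound may depend on p = k + d only, and `N` need not be monotone. Adding its values for
-- all d ≤ p covers whichever d occurs.
depthBound : (ℕ → ℕ) → (ℕ × ℕ → ℕ) → ℕ → ℕ
depthBound s N p = total (λ d → N (d , scatterSize s p d)) (suc p)

-- Chosen to be at least 2, k, d and the number (1 + k) ^ L of nodes at once.
base : (ℕ → ℕ) → (ℕ × ℕ → ℕ) → ℕ → ℕ
base s N p = (2 + p) ^ suc (depthBound s N p)

module _ {s : ℕ → ℕ} {N : ℕ × ℕ → ℕ} (Ps PN : Program)
         (s-computable : ∀ d → ∃[ t ] Ps on num d yields num (s d) within t)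
         (N-computable : ∀ dm → ∃[ t ] PN on numPair dm yields num (N dm) within t) where

  scatterSizeT summandT totalStep : Tm
  scatterSizeT =
    bind (seq (ret (# 1)) (prog Ps))
    (bind (call₂ mulT (# 0) (cons nil (# 2)))
    (bind (call₂ powT (numeral 2) (# 0))
    (bind (call₂ mulT (# 0) (cons nil (# 3)))
    (ret (cons nil (# 0))))))
  summandT     = bind scatterSizeT (seq (ret (cons (# 2) (# 0))) (prog PN))
  totalStep    =
    bind (call₂ summandT (# 2) (hd (# 1)))
    (bind (call₂ addT (# 0) (tl (# 2)))
    (ret (cons (cons nil (hd (# 3))) (# 0))))

  baseT : ℕ → Tm
  baseT e =
    seq (ret (cons (tails 0) nil))
    (bind (fold (cons nil (# 0)) (cons nil nil) totalStep)
    (bind (call₂ powT (cons nil (cons nil (# 1))) (cons nil (tl (# 0))))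
    (call₂ powT (# 0) (numeral e))))

  ↦-summand : ∀ p d {ρ} → summandT ⊩ num p ∙ num d ∙ ρ ↦ num (N (d , scatterSize s p d))
  ↦-summand p d =
    ↦-bind
      (↦-bind (↦-seq (↦-ret refl) (↦-prog (proj₂ (s-computable d))))
      (↦-bind (↦-call₂ (↦-mul (s d) (suc d)))
      (↦-bind (↦-call₂ (↦-pow 2 (s d * suc d)))
      (↦-bind (↦-call₂ (↦-mul (2 ^ (s d * suc d)) (suc p)))
      (↦-ret refl)))))
    (↦-seq (↦-ret refl) (↦-prog (proj₂ (N-computable (d , scatterSize s p d)))))

  ↦-base : ∀ e p → baseT e ⊩ num p ↦ num (base s N p ^ e)
  ↦-base e p =
    ↦-seq (↦-ret refl)
    (↦-bind
      (↦-fold (suc p) (λ i → num i ∙ num (total f i)) refl refl λ i →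
        ↦-bind (↦-call₂ (↦-summand p i))
        (↦-bind (↦-call₂ (↦-add (f i) (total f i)))
        (↦-ret refl)))
    (↦-bind (↦-call₂ (↦-pow (2 + p) (suc (total f (suc p)))))
    (↦-call₂ (subst (λ l → powT ⊩ num (base s N p) ∙ l ∙ nil ↦ num (base s N p ^ e))
                    (sym (eval-numeral e)) (↦-pow (base s N p) e)))))
    where
    f : ℕ → ℕ
    f d = N (d , scatterSize s p d)

  base-computable : ∀ e → Computable num λ p → base s N p ^ e
  base-computable e = record { extraVars = 1 ; body = compile (baseT e) } , λ p →
    let open _⊩_↦_ (↦-base e p) in _ , _ , _ , run nil , refl , ≤-refl

-- From encoded instances and dominating sets to matrices and solutions

list-tabulate : ∀ {A : Set} (enc : A → 𝔻) n (f : Fin n → A) → list enc (tabulate f) ≡ tab n (enc ∘ f)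
list-tabulate enc zero    f = refl
list-tabulate enc (suc n) f = cong (enc (f zero) ∙_) (list-tabulate enc n (f ∘ suc))

subset≡bits : ∀ {n} (p : Subset n) → subset p ≡ bits (lookup p)
subset≡bits []      = refl
subset≡bits (b ∷ p) = cong (bool b ∙_) (subset≡bits p)

adjacencyMatrix≡matrix : ∀ G → adjacencyMatrix G ≡ matrix (adjacent {G})
adjacencyMatrix≡matrix G = trans (list-tabulate (list bool) order _)
  (tab-cong order λ u → list-tabulate bool order (adjacent {G} u))
  where open Graph G using (order)

^-distrib-* : ∀ m n e → (m * n) ^ e ≡ m ^ e * n ^ e
^-distrib-* m n zero    = refl
^-distrib-* m n (suc e) = trans (cong (m * n *_) (^-distrib-* m n e))
  (solve 4 (λ a b c d → a :* b :* (c :* d) ⊜ a :* c :* (b :* d)) refl m n (m ^ e) (n ^ e))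

Reflects-⇔ : ∀ {P Q : Set} {b} → P ⇔ Q → Reflects P b → Reflects Q b
Reflects-⇔ P⇔Q (ofʸ p)  = ofʸ (Equivalence.to P⇔Q p)
Reflects-⇔ P⇔Q (ofⁿ ¬p) = ofⁿ (¬p ∘ Equivalence.from P⇔Q)

module _ (x : DominationInstance) where
  open DominationInstance x
  open Graph G using (order)

  solution⇔dominating :
    (k ≤ order × ∃[ v ] (∀ u → lookup W u ≡ true → Hits k (balls (adjacent {G}) d) v u)) ⇔
    (∃[ X ] ∣ X ∣ ≡ k × Dominates G d X W)
  solution⇔dominating = mk⇔ to from
    where
    to : _ → _
    to (k≤n , v , sol) with X , ∣X∣ , v∈X ← cover k v k≤n = X , ∣X∣ , dominates
      where
      dominates : Dominates G d X W
      dominates {u} u∈W with j , eq ← sol u ([]=⇒lookup u∈W) =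
        v j , v∈X j , near⇒N (whole G) (balls-sound d u (v j) eq)
    from : _ → _
    from (X , refl , dominates) = ∣p∣≤n X , enumerate X , hit
      where
      hit : ∀ u → lookup W u ≡ true → Hits k (balls (adjacent {G}) d) (enumerate X) u
      hit u eq with v , v∈X , near ← dominates (lookup⇒[]= u W eq)
               with j , refl ← enumerate-surjective X v∈X =
        j , balls-complete (N⇒near (whole G) near)

-- Kept from unfolding: the exponent of searchT is too large to be computed in unary.
opaque

  search : Tm
  search = searchT

  search≡searchT : search ≡ searchT
  search≡searchT = refl

-- Assembling the decision procedure and its time bound

module _ {ℓ} {𝒞 : Pred Graph ℓ} {s𝒞 N𝒞} (uqw : UniformlyQuasiWide 𝒞 s𝒞 N𝒞)
         (x : DominationInstance) (G∈𝒞 : 𝒞 (DominationInstance.G x)) where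
  open DominationInstance x
  open ParameterizedProblem (DistanceDominatingSet 𝒞) using (encode; Yes)

  private
    n p D F B : ℕ
    n = Graph.order G
    p = k + d
    D = suc (depthBound s𝒞 N𝒞 p)
    F = base s𝒞 N𝒞 p
    -- As a product, `B` separates parameter and size: its power splits into a function of p and a
    -- polynomial in n.
    B = F * max 1 n

    1≤n′ : 1 ≤ max 1 n
    1≤n′ = m≤m⊔n 1 n

    2+p≤F : 2 + p ≤ F
    2+p≤F = ≤-trans (≤-reflexive (sym (*-identityʳ (2 + p))))
      (*-monoʳ-≤ (2 + p) (m^n>0 (2 + p) (depthBound s𝒞 N𝒞 p)))

    F≤B : F ≤ B
    F≤B = ≤-trans (≤-reflexive (sym (*-identityʳ F))) (*-monoʳ-≤ F 1≤n′)

    2≤B : 2 ≤ B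
    2≤B = ≤-trans (m≤m+n 2 p) (≤-trans 2+p≤F F≤B)

    p≤B : p ≤ B
    p≤B = ≤-trans (m≤n+m p 2) (≤-trans 2+p≤F F≤B)

    n≤B : n ≤ B
    n≤B = ≤-trans (m≤n⊔m 1 n) (≤-trans (≤-reflexive (sym (*-identityˡ _)))
      (*-monoˡ-≤ (max 1 n) (m^n>0 (2 + p) D)))

    L : ℕ
    L = N𝒞 (d , scatterSize s𝒞 p d)

    L≤ : L ≤ depthBound s𝒞 N𝒞 p
    L≤ = summand≤total (λ d → N𝒞 (d , scatterSize s𝒞 p d)) (s≤s (m≤n+m d k))

    nodes≤B : suc k ^ L ≤ B
    nodes≤B = begin
      suc k ^ L                               ≤⟨ ^-monoˡ-≤ L (s≤s (≤-trans (m≤m+n k d) (n≤1+n p))) ⟩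
      (2 + p) ^ L                             ≤⟨ ^-monoʳ-≤ (2 + p) (≤-trans L≤ (n≤1+n _)) ⟩
      F                                       ≤⟨ F≤B ⟩
      B                                       ∎
      where open ≤-Reasoning

    open Timed 2≤B

    encoded : 𝔻
    encoded = matrix (adjacent {G}) ∙ bits (lookup W) ∙ num k ∙ num d

    encode≡ : encode x ≡ encoded
    encode≡ = cong₂ _∙_ (adjacencyMatrix≡matrix G) (cong (_∙ num k ∙ num d) (subset≡bits W))

    decides : ∃[ b ] search ⊢ encoded ⇒ bool b ×
                     Reflects (Yes x) b
    decides with b , run , r ← search-correct 2≤B n≤B (≤-trans (m≤m+n k d) p≤B) (≤-trans (m≤n+m d k) p≤B)
                   (adjacent {G}) (lookup W) nodes≤B (ladder-bounded (m≤m+n k d) uqw G∈𝒞)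
      = b , subst (_⊢ encoded ⇒ bool b) (sym search≡searchT) run , Reflects-⇔ (solution⇔dominating x) r

  searchProgram-decides :
    ∃[ b ] (record { extraVars = 1 ; body = compile search }) on encode x yields bool b
             within (F ^ exponent search * max 1 n ^ exponent search) × Reflects (Yes x) b
  searchProgram-decides with b , within {τ} run bound , r ← decides =
    b , (_ , τ , subst (λ i → ⟨ compile search , i ∷ nil ∷ [] ⟩⇓⟨ bool b ∷ nil ∷ [] , τ ⟩) (sym encode≡) (run nil) ,
         refl , ≤-trans (_≼_.≼⇒≤ bound) (≤-reflexive (^-distrib-* F (max 1 n) (exponent search)))) , r

theorem4p3 :
    ∀ {ℓ} (𝒞 : Pred Graph ℓ) (s𝒞 : ℕ → ℕ) (N𝒞 : ℕ × ℕ → ℕ) →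
    NowhereDense 𝒞 →
    UniformlyQuasiWide 𝒞 s𝒞 N𝒞 →
    Computable num s𝒞 →
    Computable numPair N𝒞 →
    FixedParameterTractable (DistanceDominatingSet 𝒞)
theorem4p3 𝒞 s𝒞 N𝒞 _ uqw (Ps , s-computable) (PN , N-computable) =
  (λ p → base s𝒞 N𝒞 p ^ exponent search) , exponent search ,
  record { extraVars = 1 ; body = compile search } ,
  base-computable Ps PN s-computable N-computable (exponent search) ,
  searchProgram-decides uqw
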